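{- For all integers $k\geq 1$ and $n\geq 1$, the number $D_k(n)$ of $k$-omino towers with area $kn$ (i.e. consisting of exactly $n$ blocks, with any base length $b$, $1\le b\le n$) is \[ D_k(n)=\binom{kn-1}{n-1}\,{}_2F_1\bigl(1,\,1-n;\,(k-1)n+1;\,-1\bigr), \] where ${}_2F_1(a,b;c;z)=\sum_{m\ge 0}\frac{(a)_m(b)_m}{(c)_m}\frac{z^m}{m!}$ is the Gauss hypergeometric function and $(x)_0=1$, $(x)_m=x(x+1)\cdots(x+m-1)$.
   Context: Fix an integer $k\ge1$. A $k$-omino block is a horizontal $k\times 1$ rectangle of unit squares occupying cells $(x,y),(x+1,y),\dots,(x+k-1,y)$ of the integer grid; $y$ is its level and $\{x,\dots,x+k-1\}$ its column set. For integers $n\ge b\ge1$, an $(n,b)$-$k$-omino tower is a finite set of $n$ pairwise non-overlapping horizontal $k$-omino blocks such that: (i) exactly $b$ of them (the base) lie at level $0$ and they occupy a contiguous horizontal run of $bk$ cells; (ii) the other $n-b$ blocks lie at levels $\ge1$, and every such block at columns $\{x,\dots,x+k-1\}$ and level $y$ has some block at level $y-1$ whose column set intersects $\{x,\dots,x+k-1\}$ (equivalently, some block occupies one of the $2k-1$ positions from $\{x-k+1,\dots,x\}$ to $\{x+k-1,\dots,x+2k-2\}$ at level $y-1$). Towers are fixed polyominoes, i.e. two towers are the same if one is a horizontal translate of the other. A $k$-omino tower of area $kn$ is an $(n,b)$-$k$-omino tower for some $1\le b\le n$. -}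

module Defs where

open import Data.Nat as ℕ using (ℕ; zero; suc; _!)
open import Data.Nat.Combinatorics using (_C_)
open import Data.Integer as ℤ using (ℤ; +_)
open import Data.Rational as ℚ using (ℚ; 0ℚ; 1ℚ; _÷_; ≢-nonZero)
open import Data.Rational.Properties as ℚP using ()
open import Data.Product using (Σ; ∃; _×_; _,_; proj₁; proj₂)
open import Data.Sum using (_⊎_)
open import Data.List using (List; length)
open import Data.List.Membership.Propositional using (_∈_)
open import Data.List.Relation.Unary.All using (All)
open import Data.List.Relation.Unary.AllPairs using (AllPairs)
open import Data.List.Relation.Unary.Linked using (Linked)
open import Data.List.Relation.Unary.Unique.Propositional using (Unique)
open import Relation.Binary.PropositionalEquality using (_≡_; _≢_)
open import Relation.Nullary using (yes; no)

-- A horizontal k-omino block: (x , y) occupies cells (x,y),…,(x+k-1,y).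
Block : Set
Block = ℤ × ℕ

col : Block → ℤ
col = proj₁

lev : Block → ℕ
lev = proj₂

-- Strict lexicographic order on blocks (level first, then column);
-- used only to pick a canonical list representation of a finite set.
_≺_ : Block → Block → Set
p ≺ q = (lev p ℕ.< lev q) ⊎ ((lev p ≡ lev q) × (col p ℤ.< col q))

NonOverlap : ℕ → Block → Block → Set
NonOverlap k p q =
  (lev p ≢ lev q) ⊎ ((col p ℤ.+ + k ℤ.≤ col q) ⊎ (col q ℤ.+ + k ℤ.≤ col p))

ColumnsMeet : ℕ → ℤ → ℤ → Set
ColumnsMeet k x x' = (x' ℤ.< x ℤ.+ + k) × (x ℤ.< x' ℤ.+ + k)


-- The tower S (a finite set of blocks, given canonically as a strictly
-- ≺-increasing list, normalised by translation so that the base starts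
-- at column 0) is an (n,b)-k-omino tower.
IsTower : (k n b : ℕ) → List Block → Set
IsTower k n b S =
    Linked _≺_ S
  × length S ≡ n
  × AllPairs (NonOverlap k) S
  × (∀ i → i ℕ.< b → (+ (i ℕ.* k) , 0) ∈ S)
  × (∀ x → (x , 0) ∈ S → ∃ λ i → (i ℕ.< b) × (x ≡ + (i ℕ.* k)))
  × (∀ x y → (x , suc y) ∈ S → ∃ λ x' → ((x' , y) ∈ S) × ColumnsMeet k x x')

IsTowerArea : (k n : ℕ) → List Block → Set
IsTowerArea k n S = ∃ λ b → (1 ℕ.≤ b) × (b ℕ.≤ n) × IsTower k n b S

-- D k n d : the list Ts enumerates all k-omino towers of area kn
-- (up to translation), each exactly once, and has length d.
-- So "∃ Ts, Enumerates k n Ts × length Ts ≡ d" means D_k(n) = d.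
Enumerates : (k n : ℕ) → List (List Block) → Set
Enumerates k n Ts = Unique Ts × (∀ S → (S ∈ Ts → IsTowerArea k n S) × (IsTowerArea k n S → S ∈ Ts))

ℕ→ℚ : ℕ → ℚ
ℕ→ℚ m = + m ℚ./ 1

-- Total division (x / 0 := 0); only ever applied to nonzero denominators here.
_/?_ : ℚ → ℚ → ℚ
x /? y with y ℚP.≟ 0ℚ
... | yes _  = 0ℚ
... | no y≢0 = _÷_ x y {{≢-nonZero y≢0}}

poch : ℚ → ℕ → ℚ
poch x zero    = 1ℚ
poch x (suc m) = poch x m ℚ.* (x ℚ.+ ℕ→ℚ m)

_^ℚ_ : ℚ → ℕ → ℚ
z ^ℚ zero  = 1ℚ
z ^ℚ suc m = (z ^ℚ m) ℚ.* z

hypTerm : ℚ → ℚ → ℚ → ℚ → ℕ → ℚ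
hypTerm a b c z m =
  (poch a m ℚ.* poch b m ℚ.* (z ^ℚ m)) /? (poch c m ℚ.* ℕ→ℚ (m !))

hypPartial : ℚ → ℚ → ℚ → ℚ → ℕ → ℚ
hypPartial a b c z zero    = 0ℚ
hypPartial a b c z (suc N) = hypPartial a b c z N ℚ.+ hypTerm a b c z N

-- ₂F₁(a, -d; c; z) for a nonpositive integer second parameter -d:
-- the series terminates, since (-d)_m = 0 for m > d, so it is the finite
-- sum over 0 ≤ m ≤ d.
₂F₁-terminating : (a : ℚ) (d : ℕ) (c z : ℚ) → ℚ
₂F₁-terminating a d c z = hypPartial a (ℚ.- ℕ→ℚ d) c z (suc d)

{-# OPTIONS --safe #-}
module Submission where

-- A tower is a heap of segments of length k.  Call a block free if no higher
-- block meets its columns.  Removing the rightmost free block of a tower with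
-- more than one block leaves a tower, so a tower is built in exactly one way by
-- successively dropping blocks, each becoming the rightmost free one; that is,
-- each new column x satisfies w < x + k, where w is the previous column.  If M is the
-- largest column so far, every column strictly between w - k and M + k meets
-- some block, so a new base block can only be dropped at x = M + k, and only
-- while M is itself the column of the last base block.
--
-- The number of ways to drop n further blocks thus depends only on h = M - w
-- and on whether the base may still grow.  By the hockey-stick identity it is
-- C(k n + k - 1 + h, n) if it may not, and the sum of C(k n + k - 1 + h, j) over
-- j ≤ n if it may.  Hence D_k(n) is the sum of C(k n - 1, j) over j < n, which is
-- the terminating hypergeometric series read backwards.

open import Defs
open import Data.Nat using (ℕ; _≤_; _*_; _∸_; _+_)
open import Data.Nat.Combinatorics using (_C_)
open import Data.List using (List; length)
open import Data.Product using (∃; _×_)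
open import Data.Rational using (ℚ; -_; 1ℚ) renaming (_*_ to _*ℚ_)
open import Relation.Binary.PropositionalEquality using (_≡_)

open import Algebra.Properties.AbelianGroup using (∙-cancelˡ)
open import Data.Bool using (Bool; true; false; if_then_else_)
open import Data.Integer as ℤ using (ℤ; +_)
import Data.Integer.Properties as ℤₚ
import Data.Integer.Tactic.RingSolver as ℤR
open import Data.List using ([]; _∷_; _++_; map; concatMap; drop; applyUpTo)
open import Data.List.Membership.Propositional using (_∈_; _∉_; lose; find)
open import Data.List.Membership.Propositional.Properties
  using (∈-concatMap⁺; ∈-concatMap⁻; ∈-applyUpTo⁺; ∈-applyUpTo⁻; ∈-map⁺; ∈-map⁻; ∈-++⁺ˡ; ∈-++⁺ʳ; ∈-++⁻; ∈-∃++)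
open import Data.List.Properties using (∷-injective; drop-drop; length-++; length-map; concatMap-++)
open import Data.List.Relation.Binary.Permutation.Propositional
  using (_↭_; refl; prep; swap; trans; ↭-refl; ↭-sym; ↭-reflexive; ↭⇒↭ₛ)
open import Data.List.Relation.Binary.Permutation.Propositional.Properties
  using (All-resp-↭; ∈-resp-↭; ↭-length; drop-∷; shift)
open import Data.List.Relation.Binary.Permutation.Setoid.Properties using (AllPairs-resp-↭)
open import Data.List.Relation.Unary.All as All using (All; []; _∷_)
import Data.List.Relation.Unary.All.Properties as Allₚ
open import Data.List.Relation.Unary.AllPairs as AllPairs using (AllPairs; []; _∷_)
import Data.List.Relation.Unary.AllPairs.Properties as AllPairsₚ
open import Data.List.Relation.Unary.Any as Any using (Any; here; there)
open import Data.List.Relation.Unary.Linked.Properties using (Linked⇒AllPairs; AllPairs⇒Linked)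
open import Data.List.Relation.Unary.Unique.Propositional using (Unique)
import Data.List.Relation.Unary.Unique.Propositional.Properties as Uniqueₚ
open import Data.Nat using (zero; suc; _<_; _⊔_; _!; z≤n; s≤s)
open import Data.Nat.Combinatorics
  using (nCn≡1; nC1≡n; nCk≡nC[n∸k]; nCk+nC[k+1]≡[n+1]C[k+1]; k>n⇒nCk≡0)
import Data.Nat.Properties as ℕₚ
import Data.Nat.Tactic.RingSolver as ℕR
open import Data.Product using (_,_; proj₁; proj₂)
open import Data.Rational using (0ℚ; toℚᵘ; ≢-nonZero; 1/_) renaming (_+_ to _+ℚ_)
import Data.Rational.Properties as ℚₚ
open import Data.Rational.Solver using (module +-*-Solver)
import Data.Rational.Unnormalised as ℚᵘ
import Data.Rational.Unnormalised.Properties as ℚᵘₚ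
open import Data.Sum using (_⊎_; inj₁; inj₂)
open import Data.Unit using (⊤; tt)
open import Function using (_∘_)
open import Relation.Binary.Definitions using (tri<; tri≈; tri>; Symmetric)
open import Relation.Binary.PropositionalEquality as ≡ using (_≢_; refl; cong; cong₂; sym; subst)
open import Relation.Nullary using (¬_; Dec; yes; no; contradiction)
open import Relation.Nullary.Decidable using (_×-dec_; _⊎-dec_; _→-dec_; ¬?)

-- Binomial identities: absorption, hockey stick, partial row sums.

nC0≡1 : ∀ n → n C 0 ≡ 1
nC0≡1 zero    = refl
nC0≡1 (suc n) = ≡.trans (nCk≡nC[n∸k] {0} {suc n} z≤n) (nCn≡1 (suc n))

-- By Pascal's rule the bracket is `suc n C suc j`, so this is the absorption identity. The expanded
-- form lets the induction on `n` combine the cases `j` and `suc j`.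
[1+j][nCj+nC[1+j]]≡[1+n]nCj : ∀ n j → suc j * (n C j + n C suc j) ≡ suc n * (n C j)
[1+j][nCj+nC[1+j]]≡[1+n]nCj zero zero = refl
[1+j][nCj+nC[1+j]]≡[1+n]nCj zero (suc j)
  rewrite k>n⇒nCk≡0 {0} {suc j} (s≤s z≤n) | k>n⇒nCk≡0 {0} {suc (suc j)} (s≤s z≤n) = ℕₚ.*-zeroʳ (suc (suc j))
[1+j][nCj+nC[1+j]]≡[1+n]nCj (suc n) zero rewrite nC1≡n (suc n) | nC0≡1 (suc n) = ≡.trans (ℕₚ.*-identityˡ _) (sym (ℕₚ.*-identityʳ _))
[1+j][nCj+nC[1+j]]≡[1+n]nCj (suc n) (suc j)
  rewrite sym (nCk+nC[k+1]≡[n+1]C[k+1] n j) | sym (nCk+nC[k+1]≡[n+1]C[k+1] n (suc j)) = begin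
    suc (suc j) * ((a + b) + (b + c))                       ≡⟨ split j a b c ⟩
    suc (suc j) * (b + c) + (suc j * (a + b) + (a + b))     ≡⟨ cong₂ (λ u v → u + (v + (a + b)))
                                                                 ([1+j][nCj+nC[1+j]]≡[1+n]nCj n (suc j))
                                                                 ([1+j][nCj+nC[1+j]]≡[1+n]nCj n j) ⟩
    suc n * b + (suc n * a + (a + b))                       ≡⟨ join n a b ⟩
    suc (suc n) * (a + b)                                   ∎
  where
  open ≡.≡-Reasoning
  a = n C j
  b = n C suc j
  c = n C suc (suc j)
  split : ∀ j a b c → suc (suc j) * ((a + b) + (b + c)) ≡ suc (suc j) * (b + c) + (suc j * (a + b) + (a + b))
  split = ℕR.solve-∀
  join : ∀ n a b → suc n * b + (suc n * a + (a + b)) ≡ suc (suc n) * (a + b)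
  join = ℕR.solve-∀

-- Absorption with one summand cancelled. The upper index is written `j + r` to avoid truncated
-- subtraction.
[1+j]nC[1+j]≡[n∸j]nCj : ∀ j r → suc j * ((j + r) C suc j) ≡ r * ((j + r) C j)
[1+j]nC[1+j]≡[n∸j]nCj j r = ℕₚ.+-cancelˡ-≡ (suc j * a) _ _ (begin
    suc j * a + suc j * b   ≡⟨ ℕₚ.*-distribˡ-+ (suc j) a b ⟨
    suc j * (a + b)         ≡⟨ [1+j][nCj+nC[1+j]]≡[1+n]nCj (j + r) j ⟩
    suc (j + r) * a         ≡⟨ ℕₚ.*-distribʳ-+ a (suc j) r ⟩
    suc j * a + r * a       ∎)
  where
  open ≡.≡-Reasoning
  a = (j + r) C j
  b = (j + r) C suc j

Σ< : ℕ → (ℕ → ℕ) → ℕ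
Σ< zero    f = 0
Σ< (suc m) f = f 0 + Σ< m (f ∘ suc)

Σ<-cong : ∀ m {f g} → (∀ i → f i ≡ g i) → Σ< m f ≡ Σ< m g
Σ<-cong zero    eq = refl
Σ<-cong (suc m) eq = cong₂ _+_ (eq 0) (Σ<-cong m (eq ∘ suc))

C-sum : ℕ → ℕ → ℕ
C-sum n zero    = 0
C-sum n (suc m) = C-sum n m + n C m

-- The extra term `N C suc n` absorbs the first summand by Pascal's rule, which raises `N` by one
-- and shortens the sum.
hockey-stick : ∀ N n m → N C suc n + Σ< m (λ i → (N + i) C n) ≡ (N + m) C suc n
hockey-stick N n zero    = ≡.trans (ℕₚ.+-identityʳ _) (cong (_C suc n) (sym (ℕₚ.+-identityʳ N)))
hockey-stick N n (suc m) = begin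
  N C suc n + ((N + 0) C n + Σ< m (λ i → (N + suc i) C n))
    ≡⟨ cong₂ (λ u v → N C suc n + (u C n + v)) (ℕₚ.+-identityʳ N) (Σ<-cong m (λ i → cong (_C n) (ℕₚ.+-suc N i))) ⟩
  N C suc n + (N C n + Σ< m (λ i → (suc N + i) C n))
    ≡⟨ ℕₚ.+-assoc (N C suc n) _ _ ⟨
  N C suc n + N C n + Σ< m (λ i → (suc N + i) C n)
    ≡⟨ cong (_+ Σ< m (λ i → (suc N + i) C n)) (≡.trans (ℕₚ.+-comm (N C suc n) _) (nCk+nC[k+1]≡[n+1]C[k+1] N n)) ⟩
  suc N C suc n + Σ< m (λ i → (suc N + i) C n)
    ≡⟨ hockey-stick (suc N) n m ⟩
  (suc N + m) C suc n
    ≡⟨ cong (_C suc n) (ℕₚ.+-suc N m) ⟨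
  (N + suc m) C suc n ∎
  where open ≡.≡-Reasoning

-- Partial row sums inherit Pascal's rule term by term, which gives them a hockey-stick identity as
-- well.
C-sum-pascal : ∀ N n → C-sum N (suc n) + C-sum N n ≡ C-sum (suc N) (suc n)
C-sum-pascal N zero    = ≡.trans (ℕₚ.+-identityʳ _) (≡.trans (nC0≡1 N) (sym (nC0≡1 (suc N))))
C-sum-pascal N (suc n) = begin
  (C-sum N (suc n) + N C suc n) + (C-sum N n + N C n)  ≡⟨ shuffle (C-sum N (suc n)) _ _ _ ⟩
  (C-sum N (suc n) + C-sum N n) + (N C n + N C suc n)  ≡⟨ cong₂ _+_ (C-sum-pascal N n) (nCk+nC[k+1]≡[n+1]C[k+1] N n) ⟩
  C-sum (suc N) (suc n) + suc N C suc n                ∎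
  where
  open ≡.≡-Reasoning
  shuffle : ∀ a b c d → (a + b) + (c + d) ≡ (a + c) + (d + b)
  shuffle = ℕR.solve-∀

C-sum-hockey-stick : ∀ N n m → C-sum N (suc n) + Σ< m (λ i → C-sum (N + i) n) ≡ C-sum (N + m) (suc n)
C-sum-hockey-stick N n zero    = ≡.trans (ℕₚ.+-identityʳ _) (cong (λ u → C-sum u (suc n)) (sym (ℕₚ.+-identityʳ N)))
C-sum-hockey-stick N n (suc m) = begin
  C-sum N (suc n) + (C-sum (N + 0) n + Σ< m (λ i → C-sum (N + suc i) n))
    ≡⟨ cong₂ (λ u v → C-sum N (suc n) + (C-sum u n + v)) (ℕₚ.+-identityʳ N)
         (Σ<-cong m (λ i → cong (λ u → C-sum u n) (ℕₚ.+-suc N i))) ⟩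
  C-sum N (suc n) + (C-sum N n + Σ< m (λ i → C-sum (suc N + i) n))
    ≡⟨ ℕₚ.+-assoc (C-sum N (suc n)) _ _ ⟨
  C-sum N (suc n) + C-sum N n + Σ< m (λ i → C-sum (suc N + i) n)
    ≡⟨ cong (_+ Σ< m (λ i → C-sum (suc N + i) n)) (C-sum-pascal N n) ⟩
  C-sum (suc N) (suc n) + Σ< m (λ i → C-sum (suc N + i) n)
    ≡⟨ C-sum-hockey-stick (suc N) n m ⟩
  C-sum (suc N + m) (suc n)
    ≡⟨ cong (λ u → C-sum u (suc n)) (ℕₚ.+-suc N m) ⟨
  C-sum (N + suc m) (suc n) ∎
  where open ≡.≡-Reasoning

-- Closed forms for the number of ways to drop further blocks.

module Count (k' : ℕ) where

  k : ℕ
  k = suc k'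

  -- The flag says whether the base may still be extended.
  count : ℕ → Bool → ℕ → ℕ
  count zero    ph h = 1
  count (suc n) ph h = (if ph then count n true 0 else 0) + (k' * count n false 0 + Σ< (h + k) (count n ph))

  private
    N : ℕ → ℕ
    N n = k * n + k'

    -- Since `N n` exceeds `n` by `k' * suc n`, the factor `suc n` cancels from the absorption
    -- identity.
    k'*C : ∀ n → k' * (N n C n) ≡ N n C suc n
    k'*C n = ℕₚ.*-cancelˡ-≡ _ _ (suc n) (begin
        suc n * (k' * (N n C n))                     ≡⟨ assoc (suc n) k' _ ⟩
        (k' * suc n) * (N n C n)                     ≡⟨ cong (λ u → (k' * suc n) * (u C n)) (N≡ n k') ⟩
        (k' * suc n) * ((n + k' * suc n) C n)        ≡⟨ [1+j]nC[1+j]≡[n∸j]nCj n (k' * suc n) ⟨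
        suc n * ((n + k' * suc n) C suc n)           ≡⟨ cong (λ u → suc n * (u C suc n)) (N≡ n k') ⟨
        suc n * (N n C suc n)                        ∎)
      where
      open ≡.≡-Reasoning
      N≡ : ∀ n k' → suc k' * n + k' ≡ n + k' * suc n
      N≡ = ℕR.solve-∀
      assoc : ∀ a b c → a * (b * c) ≡ (b * a) * c
      assoc = ℕR.solve-∀

    N-suc : ∀ n h → N n + (h + k) ≡ N (suc n) + h
    N-suc n h = lemma k' n h
      where
      lemma : ∀ k' n h → suc k' * n + k' + (h + suc k') ≡ suc k' * suc n + k' + h
      lemma = ℕR.solve-∀

  -- The `k'` moves that raise the maximum supply the initial term of the hockey-stick identity, and
  -- the `h + k` remaining moves supply its sum.
  count-false : ∀ n h → count n false h ≡ (k * n + k' + h) C n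
  count-false zero    h = sym (nC0≡1 (N 0 + h))
  count-false (suc n) h = begin
    k' * count n false 0 + Σ< (h + k) (count n false)
      ≡⟨ cong₂ (λ u v → k' * u + v) (≡.trans (count-false n 0) (cong (_C n) (ℕₚ.+-identityʳ (N n))))
           (Σ<-cong (h + k) (count-false n)) ⟩
    k' * (N n C n) + Σ< (h + k) (λ i → (N n + i) C n)
      ≡⟨ cong (_+ Σ< (h + k) (λ i → (N n + i) C n)) (k'*C n) ⟩
    N n C suc n + Σ< (h + k) (λ i → (N n + i) C n)
      ≡⟨ hockey-stick (N n) n (h + k) ⟩
    (N n + (h + k)) C suc n
      ≡⟨ cong (_C suc n) (N-suc n h) ⟩
    (N (suc n) + h) C suc n ∎
    where open ≡.≡-Reasoning

  -- A new base block contributes a row sum of `suc n` terms. The `k'` moves that close the base add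
  -- the next binomial, which completes the initial term of the hockey-stick identity for row sums.
  count-true : ∀ n h → count n true h ≡ C-sum (k * n + k' + h) (suc n)
  count-true zero    h = sym (nC0≡1 (N 0 + h))
  count-true (suc n) h = begin
    count n true 0 + (k' * count n false 0 + Σ< (h + k) (count n true))
      ≡⟨ cong₂ _+_ (≡.trans (count-true n 0) (cong (λ u → C-sum u (suc n)) (ℕₚ.+-identityʳ (N n))))
           (cong₂ (λ u v → k' * u + v) (≡.trans (count-false n 0) (cong (_C n) (ℕₚ.+-identityʳ (N n))))
             (Σ<-cong (h + k) (count-true n))) ⟩
    C-sum (N n) (suc n) + (k' * (N n C n) + S)
      ≡⟨ cong (λ u → C-sum (N n) (suc n) + (u + S)) (k'*C n) ⟩
    C-sum (N n) (suc n) + (N n C suc n + S)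
      ≡⟨ ℕₚ.+-assoc (C-sum (N n) (suc n)) _ _ ⟨
    C-sum (N n) (suc (suc n)) + S
      ≡⟨ C-sum-hockey-stick (N n) (suc n) (h + k) ⟩
    C-sum (N n + (h + k)) (suc (suc n))
      ≡⟨ cong (λ u → C-sum u (suc (suc n))) (N-suc n h) ⟩
    C-sum (N (suc n) + h) (suc (suc n)) ∎
    where
    open ≡.≡-Reasoning
    S = Σ< (h + k) (λ i → C-sum (N n + i) (suc n))

-- Natural numbers inside the rationals.

toℚᵘ-ℕ→ℚ : ∀ m → toℚᵘ (ℕ→ℚ m) ℚᵘ.≃ ℚᵘ.mkℚᵘ (+ m) 0
toℚᵘ-ℕ→ℚ m = ℚₚ.toℚᵘ-fromℚᵘ (ℚᵘ.mkℚᵘ (+ m) 0)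

ℕ→ℚ-+ : ∀ m n → ℕ→ℚ (m + n) ≡ ℕ→ℚ m +ℚ ℕ→ℚ n
ℕ→ℚ-+ m n = ℚₚ.toℚᵘ-injective (begin
  toℚᵘ (ℕ→ℚ (m + n))                        ≈⟨ toℚᵘ-ℕ→ℚ (m + n) ⟩
  ℚᵘ.mkℚᵘ (+ (m + n)) 0                     ≈⟨ ℚᵘ.*≡* (cong (ℤ._* + 1) (cong₂ ℤ._+_ (sym (ℤₚ.*-identityʳ (+ m))) (sym (ℤₚ.*-identityʳ (+ n))))) ⟩
  ℚᵘ.mkℚᵘ (+ m) 0 ℚᵘ.+ ℚᵘ.mkℚᵘ (+ n) 0      ≈⟨ ℚᵘₚ.+-cong (toℚᵘ-ℕ→ℚ m) (toℚᵘ-ℕ→ℚ n) ⟨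
  toℚᵘ (ℕ→ℚ m) ℚᵘ.+ toℚᵘ (ℕ→ℚ n)            ≈⟨ ℚₚ.toℚᵘ-homo-+ (ℕ→ℚ m) (ℕ→ℚ n) ⟨
  toℚᵘ (ℕ→ℚ m +ℚ ℕ→ℚ n)                     ∎)
  where open ℚᵘₚ.≃-Reasoning

ℕ→ℚ-* : ∀ m n → ℕ→ℚ (m * n) ≡ ℕ→ℚ m *ℚ ℕ→ℚ n
ℕ→ℚ-* m n = ℚₚ.toℚᵘ-injective (begin
  toℚᵘ (ℕ→ℚ (m * n))                        ≈⟨ toℚᵘ-ℕ→ℚ (m * n) ⟩
  ℚᵘ.mkℚᵘ (+ (m * n)) 0                     ≈⟨ ℚᵘ.*≡* (cong (ℤ._* + 1) (ℤₚ.pos-* m n)) ⟩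
  ℚᵘ.mkℚᵘ (+ m) 0 ℚᵘ.* ℚᵘ.mkℚᵘ (+ n) 0      ≈⟨ ℚᵘₚ.*-cong (toℚᵘ-ℕ→ℚ m) (toℚᵘ-ℕ→ℚ n) ⟨
  toℚᵘ (ℕ→ℚ m) ℚᵘ.* toℚᵘ (ℕ→ℚ n)            ≈⟨ ℚₚ.toℚᵘ-homo-* (ℕ→ℚ m) (ℕ→ℚ n) ⟨
  toℚᵘ (ℕ→ℚ m *ℚ ℕ→ℚ n)                     ∎)
  where open ℚᵘₚ.≃-Reasoning

ℕ→ℚ-suc≢0 : ∀ m → ℕ→ℚ (suc m) ≢ 0ℚ
ℕ→ℚ-suc≢0 m eq with ℚᵘₚ.≃-trans (ℚᵘₚ.≃-sym (toℚᵘ-ℕ→ℚ (suc m))) (ℚᵘₚ.≃-reflexive (cong toℚᵘ eq))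
... | ℚᵘ.*≡* ()

*-/?-cancel : ∀ a b x y → y ≢ 0ℚ → a *ℚ x ≡ b *ℚ y → a *ℚ (x /? y) ≡ b
*-/?-cancel a b x y y≢0 eq with y ℚₚ.≟ 0ℚ
... | yes y≡0 = contradiction y≡0 y≢0
... | no  y≢0′ = begin
  a *ℚ (x *ℚ 1/ y)    ≡⟨ ℚₚ.*-assoc a x (1/ y) ⟨
  (a *ℚ x) *ℚ 1/ y    ≡⟨ cong (_*ℚ 1/ y) eq ⟩
  (b *ℚ y) *ℚ 1/ y    ≡⟨ ℚₚ.*-assoc b y (1/ y) ⟩
  b *ℚ (y *ℚ 1/ y)    ≡⟨ cong (b *ℚ_) (ℚₚ.*-inverseʳ y) ⟩
  b *ℚ 1ℚ             ≡⟨ ℚₚ.*-identityʳ b ⟩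
  b                   ∎
  where
  open ≡.≡-Reasoning
  instance _ = ≢-nonZero y≢0′

poch-positive : ∀ e m → ∃ λ p → poch (ℕ→ℚ (suc e)) m ≡ ℕ→ℚ (suc p)
poch-positive e zero    = 0 , refl
poch-positive e (suc m) with poch-positive e m
-- The witness is the predecessor of `suc p * suc (e + m)`.
... | p , eq = e + m + p * suc (e + m) , (begin
  poch (ℕ→ℚ (suc e)) m *ℚ (ℕ→ℚ (suc e) +ℚ ℕ→ℚ m)  ≡⟨ cong₂ _*ℚ_ eq (sym (ℕ→ℚ-+ (suc e) m)) ⟩
  ℕ→ℚ (suc p) *ℚ ℕ→ℚ (suc e + m)                  ≡⟨ ℕ→ℚ-* (suc p) (suc e + m) ⟨
  ℕ→ℚ (suc p * suc (e + m))                       ∎)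
  where open ≡.≡-Reasoning

!-positive : ∀ m → ∃ λ p → m ! ≡ suc p
!-positive zero    = 0 , refl
!-positive (suc m) with !-positive m
... | p , eq = _ , cong (suc m *_) eq

-- The terminating series as a partial row sum of binomials.

module Hypergeometric (d e : ℕ) where

  -- For towers of `n` blocks, `d` is `n - 1` and `e` is `(k - 1) * n`, so `N` is `k * n - 1`.
  N : ℕ
  N = d + e

  num den : ℕ → ℚ
  num m = poch 1ℚ m *ℚ poch (- ℕ→ℚ d) m *ℚ ((- 1ℚ) ^ℚ m)
  den m = poch (ℕ→ℚ (suc e)) m *ℚ ℕ→ℚ (m !)

  den≢0 : ∀ m → den m ≢ 0ℚ
  den≢0 m with poch-positive e m | !-positive m
  ... | p , eq | q , eq′ rewrite eq | eq′ = λ eq″ →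
    ℕ→ℚ-suc≢0 (q + p * suc q) (≡.trans (ℕ→ℚ-* (suc p) (suc q)) eq″)

  -- The m-th term of the series, scaled by N C d, is N C (d - m).
  C*num≡C*den : ∀ m j → d ≡ m + j → ℕ→ℚ (N C d) *ℚ num m ≡ ℕ→ℚ (N C j) *ℚ den m
  C*num≡C*den zero    j refl = refl
  C*num≡C*den (suc m) j eq   = begin
    cd *ℚ ((P *ℚ (1ℚ +ℚ ιm)) *ℚ (Q *ℚ (- ℕ→ℚ d +ℚ ιm)) *ℚ (Z *ℚ (- 1ℚ)))
      ≡⟨ cong (λ u → cd *ℚ ((P *ℚ (1ℚ +ℚ ιm)) *ℚ (Q *ℚ (- u +ℚ ιm)) *ℚ (Z *ℚ (- 1ℚ))))
           (≡.trans (cong ℕ→ℚ d≡) (ℕ→ℚ-+ m (suc j))) ⟩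
    cd *ℚ ((P *ℚ (1ℚ +ℚ ιm)) *ℚ (Q *ℚ (- (ιm +ℚ ιj) +ℚ ιm)) *ℚ (Z *ℚ (- 1ℚ)))
      -- As `d = m + suc j`, the new Pochhammer factor `- d + m` is `- suc j`. Its sign cancels
      -- against the new factor `- 1` of the power.
      ≡⟨ solve 6 (λ cd P Q Z ιm ιj →
           cd :* ((P :* (con 1ℚ :+ ιm)) :* (Q :* (:- (ιm :+ ιj) :+ ιm)) :* (Z :* con (- 1ℚ)))
           := (cd :* (P :* Q :* Z)) :* ((con 1ℚ :+ ιm) :* ιj)) refl cd P Q Z ιm ιj ⟩
    (cd *ℚ num m) *ℚ ((1ℚ +ℚ ιm) *ℚ ιj)
      ≡⟨ cong (_*ℚ ((1ℚ +ℚ ιm) *ℚ ιj)) (C*num≡C*den m (suc j) d≡) ⟩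
    (ℕ→ℚ (N C suc j) *ℚ (R *ℚ F)) *ℚ ((1ℚ +ℚ ιm) *ℚ ιj)
      ≡⟨ solve 5 (λ c R F u v → (c :* (R :* F)) :* (u :* v) := (v :* c) :* (R :* (u :* F)))
           refl (ℕ→ℚ (N C suc j)) R F (1ℚ +ℚ ιm) ιj ⟩
    (ιj *ℚ ℕ→ℚ (N C suc j)) *ℚ (R *ℚ ((1ℚ +ℚ ιm) *ℚ F))
      ≡⟨ cong (_*ℚ (R *ℚ ((1ℚ +ℚ ιm) *ℚ F))) absorb ⟩
    ((ℕ→ℚ (suc e) +ℚ ιm) *ℚ ℕ→ℚ (N C j)) *ℚ (R *ℚ ((1ℚ +ℚ ιm) *ℚ F))
      ≡⟨ solve 5 (λ c R F u v → (v :* c) :* (R :* (u :* F)) := c :* ((R :* v) :* (u :* F)))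
           refl (ℕ→ℚ (N C j)) R F (1ℚ +ℚ ιm) (ℕ→ℚ (suc e) +ℚ ιm) ⟩
    ℕ→ℚ (N C j) *ℚ ((R *ℚ (ℕ→ℚ (suc e) +ℚ ιm)) *ℚ ((1ℚ +ℚ ιm) *ℚ F))
      ≡⟨ cong (λ u → ℕ→ℚ (N C j) *ℚ ((R *ℚ (ℕ→ℚ (suc e) +ℚ ιm)) *ℚ u))
           (≡.trans (cong (_*ℚ F) (sym (ℕ→ℚ-+ 1 m))) (sym (ℕ→ℚ-* (suc m) (m !)))) ⟩
    ℕ→ℚ (N C j) *ℚ den (suc m) ∎
    where
    open ≡.≡-Reasoning
    open +-*-Solver
    d≡ : d ≡ m + suc j
    d≡ = ≡.trans eq (sym (ℕₚ.+-suc m j))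
    cd = ℕ→ℚ (N C d)
    P  = poch 1ℚ m
    Q  = poch (- ℕ→ℚ d) m
    Z  = (- 1ℚ) ^ℚ m
    R  = poch (ℕ→ℚ (suc e)) m
    F  = ℕ→ℚ (m !)
    ιm = ℕ→ℚ m
    ιj = ℕ→ℚ (suc j)
    N≡ : N ≡ j + (suc e + m)
    N≡ = ≡.trans (cong (_+ e) eq) (lemma m j e)
      where
      lemma : ∀ m j e → suc m + j + e ≡ j + (suc e + m)
      lemma = ℕR.solve-∀
    -- The difference of `N` and `j` is `suc e + m`, exactly the next Pochhammer factor of the
    -- denominator.
    absorb : ιj *ℚ ℕ→ℚ (N C suc j) ≡ (ℕ→ℚ (suc e) +ℚ ιm) *ℚ ℕ→ℚ (N C j)
    absorb = begin
      ιj *ℚ ℕ→ℚ (N C suc j)                     ≡⟨ ℕ→ℚ-* (suc j) (N C suc j) ⟨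
      ℕ→ℚ (suc j * (N C suc j))                 ≡⟨ cong (λ u → ℕ→ℚ (suc j * (u C suc j))) N≡ ⟩
      ℕ→ℚ (suc j * ((j + (suc e + m)) C suc j)) ≡⟨ cong ℕ→ℚ ([1+j]nC[1+j]≡[n∸j]nCj j (suc e + m)) ⟩
      ℕ→ℚ ((suc e + m) * ((j + (suc e + m)) C j)) ≡⟨ cong (λ u → ℕ→ℚ ((suc e + m) * (u C j))) N≡ ⟨
      ℕ→ℚ ((suc e + m) * (N C j))               ≡⟨ ℕ→ℚ-* (suc e + m) (N C j) ⟩
      ℕ→ℚ (suc e + m) *ℚ ℕ→ℚ (N C j)            ≡⟨ cong (_*ℚ ℕ→ℚ (N C j)) (ℕ→ℚ-+ (suc e) m) ⟩
      (ℕ→ℚ (suc e) +ℚ ιm) *ℚ ℕ→ℚ (N C j)        ∎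

  partial : ℕ → ℚ
  partial = hypPartial 1ℚ (- ℕ→ℚ d) (ℕ→ℚ (suc e)) (- 1ℚ)

  -- The scaled term of index `s` is `N C t` with `s + t = d`. It can therefore be moved from the
  -- end of the partial series to the end of the row sum, until the series is empty.
  C*partial : ∀ s t → suc d ≡ s + t → ℕ→ℚ (C-sum N t) +ℚ ℕ→ℚ (N C d) *ℚ partial s ≡ ℕ→ℚ (C-sum N (suc d))
  C*partial zero    t refl = ≡.trans (cong (ℕ→ℚ (C-sum N (suc d)) +ℚ_) (ℚₚ.*-zeroʳ (ℕ→ℚ (N C d)))) (ℚₚ.+-identityʳ _)
  C*partial (suc s) t eq   = begin
    ℕ→ℚ (C-sum N t) +ℚ cd *ℚ (partial s +ℚ term)
      ≡⟨ solve 4 (λ b c p q → b :+ c :* (p :+ q) := (b :+ c :* q) :+ c :* p)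
           refl (ℕ→ℚ (C-sum N t)) cd (partial s) term ⟩
    (ℕ→ℚ (C-sum N t) +ℚ cd *ℚ term) +ℚ cd *ℚ partial s
      ≡⟨ cong (λ u → (ℕ→ℚ (C-sum N t) +ℚ u) +ℚ cd *ℚ partial s)
           (*-/?-cancel cd (ℕ→ℚ (N C t)) (num s) (den s) (den≢0 s) (C*num≡C*den s t (ℕₚ.suc-injective eq))) ⟩
    (ℕ→ℚ (C-sum N t) +ℚ ℕ→ℚ (N C t)) +ℚ cd *ℚ partial s
      ≡⟨ cong (_+ℚ cd *ℚ partial s) (ℕ→ℚ-+ (C-sum N t) (N C t)) ⟨
    ℕ→ℚ (C-sum N (suc t)) +ℚ cd *ℚ partial s
      ≡⟨ C*partial s (suc t) (≡.trans eq (sym (ℕₚ.+-suc s t))) ⟩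
    ℕ→ℚ (C-sum N (suc d)) ∎
    where
    open ≡.≡-Reasoning
    open +-*-Solver
    cd = ℕ→ℚ (N C d)
    term = hypTerm 1ℚ (- ℕ→ℚ d) (ℕ→ℚ (suc e)) (- 1ℚ) s

  C*₂F₁≡C-sum : ℕ→ℚ (N C d) *ℚ ₂F₁-terminating 1ℚ d (ℕ→ℚ (suc e)) (- 1ℚ) ≡ ℕ→ℚ (C-sum N (suc d))
  C*₂F₁≡C-sum = ≡.trans (sym (ℚₚ.+-identityˡ _)) (C*partial (suc d) 0 (sym (ℕₚ.+-identityʳ (suc d))))

-- Auxiliary facts on lists.

-- Lets `AllPairs.map` use facts that hold for members only, such as injectivity on valid moves or
-- on reachable states.
allPairs-∈ : ∀ {A : Set} {R : A → A → Set} {xs} → AllPairs R xs →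
             AllPairs (λ x y → x ∈ xs × y ∈ xs × R x y) xs
allPairs-∈ []         = []
allPairs-∈ (px ∷ pxs) =
  All.tabulate (λ y∈ → here refl , there y∈ , All.lookup px y∈) ∷
  AllPairs.map (λ (x∈ , y∈ , r) → there x∈ , there y∈ , r) (allPairs-∈ pxs)

∈⇒↭∷ : ∀ {A : Set} {x : A} {xs} → x ∈ xs → ∃ λ ys → xs ↭ x ∷ ys
∈⇒↭∷ {x = x} x∈ with ∈-∃++ x∈
... | as , bs , refl = as ++ bs , shift x as bs

module _ {A B : Set} {_≤′_ : B → B → Set} (≤′-total : ∀ a b → (a ≤′ b) ⊎ (b ≤′ a))
         (≤′-refl : ∀ {a} → a ≤′ a) (≤′-trans : ∀ {a b c} → a ≤′ b → b ≤′ c → a ≤′ c)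
         (f : A → B) {P : A → Set} (P? : ∀ a → Dec (P a)) where

  -- Applied to levels to find a free block, and to columns to find the rightmost free one.
  maximiser : ∀ xs → Any P xs → ∃ λ x → x ∈ xs × P x × (∀ {y} → y ∈ xs → P y → f y ≤′ f x)
  maximiser (x ∷ xs) any with P? x | Any.any? P? xs
  ... | no ¬px | _ with maximiser xs (Any.tail ¬px any)
  ...   | z , z∈ , pz , max = z , there z∈ , pz ,
          λ { (here refl) py → contradiction py ¬px ; (there y∈) py → max y∈ py }
  maximiser (x ∷ xs) any | yes px | no none = x , here refl , px ,
          λ { (here refl) py → ≤′-refl ; (there y∈) py → contradiction (lose y∈ py) none }
  maximiser (x ∷ xs) any | yes px | yes some with maximiser xs some
  ... | z , z∈ , pz , max with ≤′-total (f x) (f z)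
  ...   | inj₁ fx≤fz = z , there z∈ , pz , λ { (here refl) py → fx≤fz ; (there y∈) py → max y∈ py }
  ...   | inj₂ fz≤fx = x , here refl , px ,
          λ { (here refl) py → ≤′-refl ; (there y∈) py → ≤′-trans (max y∈ py) fz≤fx }

positive⇒suc : ∀ {n} → 0 < n → ∃ λ m → n ≡ suc m
positive⇒suc (s≤s {n = m} _) = m , refl

-- Sorted lists as canonical forms of block sets.

≺-trans : ∀ {p q r} → p ≺ q → q ≺ r → p ≺ r
≺-trans (inj₁ a)       (inj₁ b)       = inj₁ (ℕₚ.<-trans a b)
≺-trans (inj₁ a)       (inj₂ (e , _)) = inj₁ (subst (_ <_) e a)
≺-trans (inj₂ (e , _)) (inj₁ b)       = inj₁ (subst (_< _) (sym e) b)
≺-trans (inj₂ (e , a)) (inj₂ (f , b)) = inj₂ (≡.trans e f , ℤₚ.<-trans a b)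

≺-irrefl : ∀ {p} → ¬ (p ≺ p)
≺-irrefl (inj₁ a)       = ℕₚ.<-irrefl refl a
≺-irrefl (inj₂ (_ , a)) = ℤₚ.<-irrefl refl a

≺-connex : ∀ p q → p ≢ q → p ≺ q ⊎ q ≺ p
≺-connex (x , y) (x′ , y′) p≢q with ℕₚ.<-cmp y y′ | ℤₚ.<-cmp x x′
... | tri< a _ _    | _             = inj₁ (inj₁ a)
... | tri> _ _ a    | _             = inj₂ (inj₁ a)
... | tri≈ _ refl _ | tri< a _ _    = inj₁ (inj₂ (refl , a))
... | tri≈ _ refl _ | tri> _ _ a    = inj₂ (inj₂ (refl , a))
... | tri≈ _ refl _ | tri≈ _ refl _ = contradiction refl p≢q

Sorted : List Block → Set
Sorted = AllPairs _≺_

-- If the heads differed, each would occur in the tail of the other list, and each would strictly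
-- precede the other.
sorted-↭⇒≡ : ∀ {xs ys} → Sorted xs → Sorted ys → xs ↭ ys → xs ≡ ys
sorted-↭⇒≡ []         []         r = refl
sorted-↭⇒≡ []         (_ ∷ _)    r with () ← ↭-length r
sorted-↭⇒≡ (_ ∷ _)    []         r with () ← ↭-length r
sorted-↭⇒≡ (px ∷ pxs) (py ∷ pys) r with ∈-resp-↭ r (here refl) | ∈-resp-↭ (↭-sym r) (here refl)
... | here refl | _         = cong (_ ∷_) (sorted-↭⇒≡ pxs pys (drop-∷ r))
... | there _   | here refl = cong (_ ∷_) (sorted-↭⇒≡ pxs pys (drop-∷ r))
... | there x∈  | there y∈  = contradiction (≺-trans (All.lookup py x∈) (All.lookup px y∈)) ≺-irrefl

_≺?_ : ∀ p q → Dec (p ≺ q)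
p ≺? q = (lev p ℕₚ.<? lev q) ⊎-dec ((lev p ℕₚ.≟ lev q) ×-dec (col p ℤₚ.<? col q))

insert : Block → List Block → List Block
insert p []       = p ∷ []
insert p (x ∷ xs) with p ≺? x
... | yes _ = p ∷ x ∷ xs
... | no  _ = x ∷ insert p xs

insert-↭ : ∀ p xs → p ∷ xs ↭ insert p xs
insert-↭ p []       = ↭-refl
insert-↭ p (x ∷ xs) with p ≺? x
... | yes _ = ↭-refl
... | no  _ = trans (swap p x ↭-refl) (prep x (insert-↭ p xs))

insert-sorted : ∀ p {xs} → All (p ≢_) xs → Sorted xs → Sorted (insert p xs)
insert-sorted p []                  []         = [] ∷ []
insert-sorted p {x ∷ xs} (p≢x ∷ p≢) (px ∷ pxs) with p ≺? x
... | yes p≺x = (p≺x ∷ All.map (≺-trans p≺x) px) ∷ px ∷ pxs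
... | no  p⊀x with ≺-connex p x p≢x
...   | inj₁ p≺x = contradiction p≺x p⊀x
...   | inj₂ x≺p = All-resp-↭ (insert-↭ p xs) (x≺p ∷ px) ∷ insert-sorted p p≢ pxs

sort : List Block → List Block
sort []       = []
sort (x ∷ xs) = insert x (sort xs)

sort-↭ : ∀ xs → xs ↭ sort xs
sort-↭ []       = ↭-refl
sort-↭ (x ∷ xs) = trans (prep x (sort-↭ xs)) (insert-↭ x (sort xs))

sort-sorted : ∀ {xs} → Unique xs → Sorted (sort xs)
sort-sorted []              = []
sort-sorted {x ∷ xs} (px ∷ pxs) = insert-sorted x (All-resp-↭ (sort-↭ xs) px) (sort-sorted pxs)

-- Overlap of columns and landing levels.

module Towers (k' : ℕ) where
  open Count k'

  Meet : ℤ → ℤ → Set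
  Meet = ColumnsMeet k

  meet? : ∀ x x′ → Dec (Meet x x′)
  meet? x x′ = (x′ ℤₚ.<? x ℤ.+ + k) ×-dec (x ℤₚ.<? x′ ℤ.+ + k)

  Meet-sym : ∀ {x x′} → Meet x x′ → Meet x′ x
  Meet-sym (a , b) = b , a

  x<x+k : ∀ x → x ℤ.< x ℤ.+ + k
  x<x+k x = subst (ℤ._< x ℤ.+ + k) (ℤₚ.+-identityʳ x) (ℤₚ.+-monoʳ-< x (ℤ.+<+ (s≤s z≤n)))

  Meet-refl : ∀ x → Meet x x
  Meet-refl x = x<x+k x , x<x+k x

  ¬Meet⇒apart : ∀ x x′ → ¬ Meet x x′ → (x ℤ.+ + k ℤ.≤ x′) ⊎ (x′ ℤ.+ + k ℤ.≤ x)
  ¬Meet⇒apart x x′ ¬m with x′ ℤₚ.<? x ℤ.+ + k | x ℤₚ.<? x′ ℤ.+ + k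
  ... | yes a | yes b = contradiction (a , b) ¬m
  ... | no  a | _     = inj₁ (ℤₚ.≮⇒≥ a)
  ... | yes _ | no  b = inj₂ (ℤₚ.≮⇒≥ b)

  apart⇒¬Meet : ∀ x x′ → (x ℤ.+ + k ℤ.≤ x′) ⊎ (x′ ℤ.+ + k ℤ.≤ x) → ¬ Meet x x′
  apart⇒¬Meet x x′ (inj₁ le) (a , b) = ℤₚ.≤⇒≯ le a
  apart⇒¬Meet x x′ (inj₂ le) (a , b) = ℤₚ.≤⇒≯ le b

  nonOverlap : ∀ p q → (Meet (col p) (col q) → lev p ≢ lev q) → NonOverlap k p q
  nonOverlap p q h with meet? (col p) (col q)
  ... | yes m = inj₁ (h m)
  ... | no ¬m = inj₂ (¬Meet⇒apart (col p) (col q) ¬m)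

  nonOverlap⇒lev≢ : ∀ {p q} → NonOverlap k p q → Meet (col p) (col q) → lev p ≢ lev q
  nonOverlap⇒lev≢         (inj₁ ne) m = ne
  nonOverlap⇒lev≢ {p} {q} (inj₂ ap) m = contradiction m (apart⇒¬Meet (col p) (col q) ap)

  NonOverlap-sym : Symmetric (NonOverlap k)
  NonOverlap-sym (inj₁ ne)       = inj₁ (ne ∘ sym)
  NonOverlap-sym (inj₂ (inj₁ a)) = inj₂ (inj₂ a)
  NonOverlap-sym (inj₂ (inj₂ a)) = inj₂ (inj₁ a)

  NonOverlap⇒≢ : ∀ {p q} → NonOverlap k p q → p ≢ q
  NonOverlap⇒≢ {p} d refl = nonOverlap⇒lev≢ {p} {p} d (Meet-refl (col p)) refl

  -- The level at which a block dropped in column `x` comes to rest.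
  height : ℤ → List Block → ℕ
  height x []      = 0
  height x (q ∷ S) with meet? x (col q)
  ... | yes _ = suc (lev q) ⊔ height x S
  ... | no  _ = height x S

  meet⇒lev<height : ∀ x {S q} → q ∈ S → Meet x (col q) → lev q < height x S
  meet⇒lev<height x {q ∷ S} (here refl) m with meet? x (col q)
  ... | yes _ = ℕₚ.m≤m⊔n (suc (lev q)) (height x S)
  ... | no ¬m = contradiction m ¬m
  meet⇒lev<height x {q ∷ S} (there r∈) m with meet? x (col q)
  ... | yes _ = ℕₚ.m≤n⇒m≤o⊔n (suc (lev q)) (meet⇒lev<height x r∈ m)
  ... | no  _ = meet⇒lev<height x r∈ m

  height-support : ∀ x S {v} → height x S ≡ suc v → ∃ λ q → q ∈ S × Meet x (col q) × lev q ≡ v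
  height-support x (q ∷ S) eq with meet? x (col q)
  ... | no  _ with height-support x S eq
  ...   | r , r∈ , m , e = r , there r∈ , m , e
  height-support x (q ∷ S) eq | yes m with ℕₚ.⊔-sel (suc (lev q)) (height x S)
  ... | inj₁ e = q , here refl , m , ℕₚ.suc-injective (≡.trans (sym e) eq)
  ... | inj₂ e with height-support x S (≡.trans (sym e) eq)
  ...   | r , r∈ , m′ , e′ = r , there r∈ , m′ , e′

  -- Serves to check that a removed block, dropped again, lands at its original level.
  height-unique : ∀ x S y → (∀ {q} → q ∈ S → Meet x (col q) → lev q < y) →
                  (y ≡ 0 ⊎ ∃ λ q → q ∈ S × Meet x (col q) × suc (lev q) ≡ y) → height x S ≡ y
  height-unique x S y below support = ℕₚ.≤-antisym upper (lower support)
    where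
    upper : height x S ≤ y
    upper with height x S in eq
    ... | zero  = z≤n
    ... | suc v with height-support x S eq
    ...   | q , q∈ , m , refl = below q∈ m
    lower : (y ≡ 0 ⊎ ∃ λ q → q ∈ S × Meet x (col q) × suc (lev q) ≡ y) → y ≤ height x S
    lower (inj₁ refl)                = z≤n
    lower (inj₂ (q , q∈ , m , refl)) = meet⇒lev<height x q∈ m

  -- Free blocks and the rightmost one among them.

  Free : Block → List Block → Set
  Free p S = All (λ q → lev p < lev q → ¬ Meet (col p) (col q)) S

  free? : ∀ S p → Dec (Free p S)
  free? S p = All.all? (λ q → (lev p ℕₚ.<? lev q) →-dec ¬? (meet? (col p) (col q))) S

  record IsTop (p : Block) (S : List Block) : Set where
    constructor isTop
    field
      member    : p ∈ S
      free      : Free p S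
      rightmost : ∀ {q} → q ∈ S → Free q S → col q ℤ.≤ col p

  IsTop-resp-↭ : ∀ {p S T} → S ↭ T → IsTop p S → IsTop p T
  IsTop-resp-↭ r (isTop p∈ f max) =
    isTop (∈-resp-↭ r p∈) (All-resp-↭ r f) (λ q∈ fq → max (∈-resp-↭ (↭-sym r) q∈) (All-resp-↭ (↭-sym r) fq))

  -- Both being rightmost, their columns agree. If their levels differed, the higher block would
  -- keep the lower one from being free.
  isTop-unique : ∀ {p q S} → IsTop p S → IsTop q S → p ≡ q
  isTop-unique {x , y} {x′ , y′} (isTop p∈ fp maxp) (isTop q∈ fq maxq)
    with ℤₚ.≤-antisym (maxq p∈ fp) (maxp q∈ fq)
  ... | refl with ℕₚ.<-cmp y y′
  ...   | tri< y<y′ _ _  = contradiction (Meet-refl x) (All.lookup fp q∈ y<y′)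
  ...   | tri≈ _ refl _  = refl
  ...   | tri> _ _ y′<y  = contradiction (Meet-refl x) (All.lookup fq p∈ y′<y)

  -- A highest block satisfying `P` is free: a higher block meeting its columns would satisfy `P`
  -- too, by the closure hypothesis.
  free-∈ : ∀ S {P : Block → Set} → (∀ p → Dec (P p)) →
           (∀ {p q} → q ∈ S → P p → lev p < lev q → Meet (col p) (col q) → P q) →
           Any P S → ∃ λ p → p ∈ S × P p × Free p S
  free-∈ S P? closed any with maximiser ℕₚ.≤-total ℕₚ.≤-refl ℕₚ.≤-trans lev P? S any
  ... | p , p∈ , pp , max = p , p∈ , pp ,
    All.tabulate (λ q∈ p<q m → ℕₚ.<⇒≱ p<q (max q∈ (closed q∈ pp p<q m)))

  top-exists : ∀ S {q} → q ∈ S → ∃ λ p → IsTop p S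
  top-exists S q∈ with free-∈ S {λ _ → ⊤} (λ _ → yes tt) (λ _ _ _ _ → tt) (lose q∈ tt)
  ... | r , r∈ , _ , fr with maximiser ℤₚ.≤-total ℤₚ.≤-refl ℤₚ.≤-trans col (free? S) S (lose r∈ fr)
  ...   | p , p∈ , fp , max = p , isTop p∈ fp max

  -- Towers and the effect of dropping a block.

  -- Sortedness and length are left out of `IsTower`, so that the latest block may head the list.
  record Tower (b : ℕ) (S : List Block) : Set where
    constructor mkTower
    field
      disjoint  : AllPairs (NonOverlap k) S
      base⊇     : ∀ i → i < b → (+ (i * k) , 0) ∈ S
      base⊆     : ∀ x → (x , 0) ∈ S → ∃ λ i → (i < b) × (x ≡ + (i * k))
      supported : ∀ x y → (x , suc y) ∈ S → ∃ λ x′ → ((x′ , y) ∈ S) × Meet x x′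

  Tower-resp-↭ : ∀ {b S T} → S ↭ T → Tower b S → Tower b T
  Tower-resp-↭ r (mkTower d b⊇ b⊆ s) = mkTower
    (AllPairs-resp-↭ (≡.setoid Block) (λ {p} {q} → NonOverlap-sym {p} {q}) (≡.resp₂ (NonOverlap k)) (↭⇒↭ₛ r) d)
    (λ i i< → ∈-resp-↭ r (b⊇ i i<))
    (λ x x∈ → b⊆ x (∈-resp-↭ (↭-sym r) x∈))
    (λ x y xy∈ → let x′ , x′∈ , m = s x y (∈-resp-↭ (↭-sym r) xy∈) in x′ , ∈-resp-↭ r x′∈ , m)

  extend : ℤ → List Block → List Block
  extend x S = (x , height x S) ∷ S

  -- An old block meeting column `x` lies below the new block, so it is no longer free. An old free
  -- block beginning at or beyond `x + k` would be to the right of `p`, the former top.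
  extend-isTop : ∀ {p S x} → IsTop p S → col p ℤ.< x ℤ.+ + k → IsTop (x , height x S) (extend x S)
  extend-isTop {p} {S} {x} (isTop _ _ max) p<x+k = isTop (here refl)
    (All.tabulate λ { (here refl) lt → contradiction lt (ℕₚ.<-irrefl refl)
                    ; (there q∈) lt m → ℕₚ.<-asym lt (meet⇒lev<height x q∈ m) })
    right
    where
    right : ∀ {q} → q ∈ extend x S → Free q (extend x S) → col q ℤ.≤ x
    right (here refl) _ = ℤₚ.≤-refl
    right {q} (there q∈) (fx ∷ fq) with meet? x (col q)
    ... | yes m = contradiction (Meet-sym m) (fx (meet⇒lev<height x q∈ m))
    ... | no ¬m with ¬Meet⇒apart x (col q) ¬m
    ...   | inj₁ a = contradiction (ℤₚ.≤-<-trans (max q∈ fq) p<x+k) (ℤₚ.≤⇒≯ a)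
    ...   | inj₂ a = ℤₚ.≤-trans (ℤₚ.<⇒≤ (x<x+k (col q))) a

  extend-disjoint : ∀ {S} x → AllPairs (NonOverlap k) S → AllPairs (NonOverlap k) (extend x S)
  extend-disjoint {S} x d =
    All.tabulate (λ {q} q∈ → nonOverlap (x , height x S) q (λ m e → ℕₚ.<-irrefl (sym e) (meet⇒lev<height x q∈ m))) ∷ d

  -- Meeting a block puts the new one above level 0, so the base is unchanged, and the block that
  -- determines `height` supports it.
  extend-supported : ∀ {b S x} → (∃ λ q → q ∈ S × Meet x (col q)) → Tower b S →
                     Tower b (extend x S) × 0 < height x S
  extend-supported {b} {S} {x} (q , q∈ , m) (mkTower d b⊇ b⊆ s) =
    mkTower (extend-disjoint x d) (λ i i< → there (b⊇ i i<)) base supp , h>0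
    where
    h>0 : 0 < height x S
    h>0 = ℕₚ.≤-<-trans z≤n (meet⇒lev<height x q∈ m)
    base : ∀ z → (z , 0) ∈ extend x S → ∃ λ i → (i < b) × (z ≡ + (i * k))
    base z (there z∈) = b⊆ z z∈
    base z (here e)   = contradiction (sym (cong lev e)) (ℕₚ.>⇒≢ h>0)
    supp : ∀ u v → (u , suc v) ∈ extend x S → ∃ λ x′ → ((x′ , v) ∈ extend x S) × Meet u x′
    supp u v (there u∈) = let x′ , x′∈ , m′ = s u v u∈ in x′ , there x′∈ , m′
    supp u v (here e) with height-support x S (sym (cong lev e))
    ... | r , r∈ , m′ , refl = col r , there r∈ , subst (λ z → Meet z (col r)) (sym (cong col e)) m′

  -- All blocks end before column `x`, so the new block meets none and falls to level 0, directly
  -- after the base.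
  extend-base : ∀ {b S x} → x ≡ + (b * k) → (∀ {q} → q ∈ S → col q ℤ.+ + k ℤ.≤ x) → Tower b S →
                height x S ≡ 0 × Tower (suc b) (extend x S)
  extend-base {b} {S} {x} x≡ left (mkTower d b⊇ b⊆ s) = h≡0 ,
    mkTower (extend-disjoint x d) base⊇ base⊆ supp
    where
    h≡0 : height x S ≡ 0
    h≡0 = height-unique x S 0 (λ {q} q∈ m → contradiction m (apart⇒¬Meet x (col q) (inj₂ (left q∈)))) (inj₁ refl)
    base⊇ : ∀ i → i < suc b → (+ (i * k) , 0) ∈ extend x S
    base⊇ i i<1+b with ℕₚ.m<1+n⇒m<n∨m≡n i<1+b
    ... | inj₁ i<b  = there (b⊇ i i<b)
    ... | inj₂ refl = here (cong₂ _,_ (sym x≡) (sym h≡0))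
    base⊆ : ∀ z → (z , 0) ∈ extend x S → ∃ λ i → (i < suc b) × (z ≡ + (i * k))
    base⊆ z (there z∈) = let i , i<b , e = b⊆ z z∈ in i , ℕₚ.m<n⇒m<1+n i<b , e
    base⊆ z (here e)   = b , ℕₚ.≤-refl , ≡.trans (cong col e) x≡
    supp : ∀ u v → (u , suc v) ∈ extend x S → ∃ λ x′ → ((x′ , v) ∈ extend x S) × Meet u x′
    supp u v (there u∈) = let x′ , x′∈ , m′ = s u v u∈ in x′ , there x′∈ , m′
    supp u v (here e)   with () ← ≡.trans (cong lev e) h≡0

  +-cancelˡ-< : ∀ x {a b} → x ℤ.+ + a ℤ.< x ℤ.+ + b → a < b
  +-cancelˡ-< x lt = ℕₚ.≰⇒> (λ b≤a → ℤₚ.<⇒≱ lt (ℤₚ.+-monoʳ-≤ x (ℤ.+≤+ b≤a)))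

  i≡i-j+j : ∀ i j → i ≡ (i ℤ.+ ℤ.- j) ℤ.+ j
  i≡i-j+j = ℤR.solve-∀

  ≤⇒∃+ : ∀ {x y} → x ℤ.≤ y → ∃ λ j → y ≡ x ℤ.+ + j
  ≤⇒∃+ {x} {y} x≤y = ℤ.∣ y ℤ.- x ∣ ,
    ≡.trans (lemma x y) (cong (λ z → x ℤ.+ z) (sym (ℤₚ.0≤i⇒+∣i∣≡i (ℤₚ.i≤j⇒0≤j-i x≤y))))
    where
    lemma : ∀ x y → y ≡ x ℤ.+ (y ℤ.- x)
    lemma = ℤR.solve-∀

  -- Here `w` and `x` are the previous and the new column, and `g` and `j` their distances below the
  -- largest column. The condition on columns becomes the bound on the natural number in a `low`
  -- move.
  <+k⇒offset< : ∀ {w x g j} → w ℤ.+ + g ≡ x ℤ.+ + j → w ℤ.< x ℤ.+ + k → j < g + k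
  <+k⇒offset< {w} {x} {g} {j} eq w<x+k = subst (j <_) (ℕₚ.+-comm k g) (+-cancelˡ-< x
    (subst (ℤ._< x ℤ.+ + (k + g)) eq (subst (w ℤ.+ + g ℤ.<_) (ℤₚ.+-assoc x (+ k) (+ g)) (ℤₚ.+-monoˡ-< (+ g) w<x+k))))

  offset<⇒<+k : ∀ {w x g j} → w ℤ.+ + g ≡ x ℤ.+ + j → j < g + k → w ℤ.< x ℤ.+ + k
  offset<⇒<+k {w} {x} {g} {j} eq j<g+k = ℤₚ.≰⇒> λ x+k≤w → ℤₚ.<⇒≱
    (ℤₚ.+-monoʳ-< x (ℤ.+<+ (subst (j <_) (ℕₚ.+-comm g k) j<g+k)))
    (subst (ℤ._≤ x ℤ.+ + j) (ℤₚ.+-assoc x (+ k) (+ g))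
      (subst ((x ℤ.+ + k) ℤ.+ + g ℤ.≤_) eq (ℤₚ.+-monoˡ-≤ (+ g) x+k≤w)))

  -- States of the dropping process and their moves.

  -- gap is maxcol minus the column of the latest block, which heads the list blocks.
  -- While phase is true, maxcol is the column of the last base block.
  record State : Set where
    constructor state
    field
      phase  : Bool
      maxcol : ℤ
      gap    : ℕ
      blocks : List Block
  open State

  data Move : Set where
    newBase : Move
    newMax  : ℕ → Move
    low     : ℕ → Move

  offset : Move → ℤ
  offset newBase    = + k
  offset (newMax j) = + suc j
  offset (low j)    = ℤ.- + j

  column : State → Move → ℤ
  column s m = maxcol s ℤ.+ offset m

  -- After `newMax` the largest column is no longer that of a base block, and the phase stays false
  -- from then on.
  next : State → Move → State
  next s newBase    = state true      (column s newBase)    0 (extend (column s newBase) (blocks s))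
  next s (newMax j) = state false     (column s (newMax j)) 0 (extend (column s (newMax j)) (blocks s))
  next s (low j)    = state (phase s) (maxcol s)            j (extend (column s (low j)) (blocks s))

  blocks-next : ∀ s m → blocks (next s m) ≡ extend (column s m) (blocks s)
  blocks-next s newBase    = refl
  blocks-next s (newMax j) = refl
  blocks-next s (low j)    = refl

  -- The `k'` columns strictly between `maxcol` and `maxcol + k` still meet a block, whereas at
  -- `maxcol + k` the block reaches level 0. The bound for `low` says that the previous column is
  -- less than the new column plus `k`.
  Valid : State → Move → Set
  Valid s newBase    = phase s ≡ true
  Valid s (newMax j) = j < k'
  Valid s (low j)    = j < gap s + k

  moves : Bool → ℕ → List Move
  moves ph h = (if ph then newBase ∷ [] else []) ++ (applyUpTo newMax k' ++ applyUpTo low (h + k))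

  ∈-moves⁺ : ∀ s {m} → Valid s m → m ∈ moves (phase s) (gap s)
  ∈-moves⁺ (state true _ _ _) {newBase}  v = here refl
  ∈-moves⁺ (state true _ _ _) {newMax j} v = there (∈-++⁺ˡ (∈-applyUpTo⁺ newMax v))
  ∈-moves⁺ (state true _ _ _) {low j}    v = there (∈-++⁺ʳ _ (∈-applyUpTo⁺ low v))
  ∈-moves⁺ (state false _ _ _) {newMax j} v = ∈-++⁺ˡ (∈-applyUpTo⁺ newMax v)
  ∈-moves⁺ (state false _ _ _) {low j}    v = ∈-++⁺ʳ _ (∈-applyUpTo⁺ low v)

  ∈-moves⁻ : ∀ s {m} → m ∈ moves (phase s) (gap s) → Valid s m
  ∈-moves⁻ s {m} m∈ with ∈-++⁻ (if phase s then newBase ∷ [] else []) m∈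
  ∈-moves⁻ (state true _ _ _) m∈ | inj₁ (here refl) = refl
  ... | inj₂ m∈′ with ∈-++⁻ (applyUpTo newMax k') m∈′
  ...   | inj₁ m∈″ with _ , j< , refl ← ∈-applyUpTo⁻ newMax m∈″ = j<
  ...   | inj₂ m∈″ with _ , j< , refl ← ∈-applyUpTo⁻ low m∈″ = j<

  newMax-injective : ∀ {i j} → newMax i ≡ newMax j → i ≡ j
  newMax-injective refl = refl

  low-injective : ∀ {i j} → low i ≡ low j → i ≡ j
  low-injective refl = refl

  moves-unique : ∀ ph h → Unique (moves ph h)
  moves-unique ph h = Uniqueₚ.++⁺ (first ph) (Uniqueₚ.++⁺
      (Uniqueₚ.applyUpTo⁺₁ newMax k' (λ i<j _ → ℕₚ.<⇒≢ i<j ∘ newMax-injective))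
      (Uniqueₚ.applyUpTo⁺₁ low (h + k) (λ i<j _ → ℕₚ.<⇒≢ i<j ∘ low-injective)) disj₁) (disj₂ ph)
    where
    first : ∀ ph → Unique (if ph then newBase ∷ [] else [])
    first true  = [] ∷ []
    first false = []
    disj₁ : ∀ {m} → ¬ (m ∈ applyUpTo newMax k' × m ∈ applyUpTo low (h + k))
    disj₁ (a , b) with ∈-applyUpTo⁻ newMax a | ∈-applyUpTo⁻ low b
    ... | _ , _ , refl | _ , _ , ()
    disj₂ : ∀ ph {m} → ¬ (m ∈ (if ph then newBase ∷ [] else []) × m ∈ applyUpTo newMax k' ++ applyUpTo low (h + k))
    disj₂ true (here refl , b) with ∈-++⁻ (applyUpTo newMax k') b
    ... | inj₁ c with _ , _ , () ← ∈-applyUpTo⁻ newMax c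
    ... | inj₂ c with _ , _ , () ← ∈-applyUpTo⁻ low c

  -- The three kinds of moves have offsets in disjoint ranges: `k` itself, from 1 to `k'`, and at
  -- most 0.
  offset-injective : ∀ s {m m′} → Valid s m → Valid s m′ → offset m ≡ offset m′ → m ≡ m′
  offset-injective s {newBase}      {newBase}      v v′ eq = refl
  offset-injective s {newBase}      {newMax _}     v v′ refl = contradiction v′ (ℕₚ.<-irrefl refl)
  offset-injective s {newBase}      {low zero}     v v′ ()
  offset-injective s {newBase}      {low (suc _)}  v v′ ()
  offset-injective s {newMax _}     {newBase}      v v′ refl = contradiction v (ℕₚ.<-irrefl refl)
  offset-injective s {newMax _}     {newMax _}     v v′ refl = refl
  offset-injective s {newMax _}     {low zero}     v v′ ()
  offset-injective s {newMax _}     {low (suc _)}  v v′ ()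
  offset-injective s {low zero}     {newBase}      v v′ ()
  offset-injective s {low (suc _)}  {newBase}      v v′ ()
  offset-injective s {low zero}     {newMax _}     v v′ ()
  offset-injective s {low (suc _)}  {newMax _}     v v′ ()
  offset-injective s {low zero}     {low zero}     v v′ eq = refl
  offset-injective s {low (suc _)}  {low (suc _)}  v v′ refl = refl

  column-injective : ∀ s {m m′} → Valid s m → Valid s m′ → column s m ≡ column s m′ → m ≡ m′
  column-injective s {m} {m′} v v′ eq = offset-injective s v v′ (∙-cancelˡ ℤₚ.+-0-abelianGroup (maxcol s) (offset m) (offset m′) eq)

  -- Enumeration of the reachable states.

  s₀ : State
  s₀ = state true (+ 0) 0 ((+ 0 , 0) ∷ [])

  data Reach : ℕ → State → Set where
    start : Reach 0 s₀
    step  : ∀ {n s} m → Reach n s → Valid s m → Reach (suc n) (next s m)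

  -- Branches on the first move, which matches the recursion of `count`. In contrast, `Reach` adds
  -- moves at the end, as suits induction by removing the latest block.
  ext : ℕ → State → List State
  ext zero    s = s ∷ []
  ext (suc n) s = concatMap (λ m → ext n (next s m)) (moves (phase s) (gap s))

  ∈-ext-suc⁻ : ∀ n s {t} → t ∈ ext (suc n) s → ∃ λ m → Valid s m × t ∈ ext n (next s m)
  ∈-ext-suc⁻ n s t∈ with find (∈-concatMap⁻ (λ m → ext n (next s m)) t∈)
  ... | m , m∈ , t∈′ = m , ∈-moves⁻ s m∈ , t∈′

  ∈-ext-suc⁺ : ∀ n s {t m} → Valid s m → t ∈ ext n (next s m) → t ∈ ext (suc n) s
  ∈-ext-suc⁺ n s v t∈ = ∈-concatMap⁺ (λ m → ext n (next s m)) (lose (∈-moves⁺ s v) t∈)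

  ext⇒Reach : ∀ n {m s t} → Reach m s → t ∈ ext n s → Reach (n + m) t
  ext⇒Reach zero    r (here refl) = r
  ext⇒Reach (suc n) {m} {s} {t} r t∈ with ∈-ext-suc⁻ n s t∈
  ... | mv , v , t∈′ = subst (λ i → Reach i t) (ℕₚ.+-suc n m) (ext⇒Reach n (step mv r v) t∈′)

  ext-next : ∀ n {s t m} → t ∈ ext n s → Valid t m → next t m ∈ ext (suc n) s
  ext-next zero    {s} (here refl) v = ∈-ext-suc⁺ 0 s v (here refl)
  ext-next (suc n) {s} t∈ v with ∈-ext-suc⁻ n s t∈
  ... | m , vm , t∈′ = ∈-ext-suc⁺ (suc n) s vm (ext-next n t∈′ v)

  Reach⇒ext : ∀ {n t} → Reach n t → t ∈ ext n s₀
  Reach⇒ext start              = here refl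
  Reach⇒ext (step {n} m r v) = ext-next n (Reach⇒ext r) v

  drop-ext : ∀ n {s t} → t ∈ ext n s → drop n (blocks t) ≡ blocks s
  drop-ext zero    (here refl) = refl
  drop-ext (suc n) {s} {t} t∈ with ∈-ext-suc⁻ n s t∈
  ... | m , v , t∈′ = begin
    drop (suc n) (blocks t)                    ≡⟨ cong (λ i → drop i (blocks t)) (ℕₚ.+-comm 1 n) ⟩
    drop (n + 1) (blocks t)                    ≡⟨ drop-drop n 1 (blocks t) ⟨
    drop 1 (drop n (blocks t))                 ≡⟨ cong (drop 1) (drop-ext n t∈′) ⟩
    drop 1 (blocks (next s m))                 ≡⟨ cong (drop 1) (blocks-next s m) ⟩
    blocks s                                   ∎
    where open ≡.≡-Reasoning

  -- Discarding the `n` latest blocks exposes the one placed by the first move. Its column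
  -- determines that move, so different first moves lead to disjoint lists.
  ext-unique : ∀ n s → Unique (ext n s)
  ext-unique zero    s = [] ∷ []
  ext-unique (suc n) s = Uniqueₚ.concat⁺
    (Allₚ.map⁺ (All.universal (λ m → ext-unique n (next s m)) _))
    (AllPairsₚ.map⁺ (AllPairs.map disj (allPairs-∈ (moves-unique (phase s) (gap s)))))
    where
    disj : ∀ {m m′} → m ∈ moves (phase s) (gap s) × m′ ∈ moves (phase s) (gap s) × m ≢ m′ →
           ∀ {t} → ¬ (t ∈ ext n (next s m) × t ∈ ext n (next s m′))
    disj {m} {m′} (m∈ , m′∈ , m≢m′) (t∈ , t∈′) =
      m≢m′ (column-injective s (∈-moves⁻ s m∈) (∈-moves⁻ s m′∈) (cong col (proj₁ (∷-injective same))))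
      where
      same : extend (column s m) (blocks s) ≡ extend (column s m′) (blocks s)
      same = ≡.trans (sym (≡.trans (drop-ext n t∈) (blocks-next s m))) (≡.trans (drop-ext n t∈′) (blocks-next s m′))

  length-concatMap-applyUpTo : ∀ {A B : Set} (f : A → List B) (g : ℕ → A) n →
    length (concatMap f (applyUpTo g n)) ≡ Σ< n (λ i → length (f (g i)))
  length-concatMap-applyUpTo f g zero    = refl
  length-concatMap-applyUpTo f g (suc n) =
    ≡.trans (length-++ (f (g 0))) (cong (λ z → length (f (g 0)) + z) (length-concatMap-applyUpTo f (g ∘ suc) n))

  Σ<-const : ∀ n c → Σ< n (λ _ → c) ≡ n * c
  Σ<-const zero    c = refl
  Σ<-const (suc n) c = cong (λ z → c + z) (Σ<-const n c)

  length-ext : ∀ n s → length (ext n s) ≡ count n (phase s) (gap s)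
  length-ext zero    s = refl
  length-ext (suc n) s = begin
    length (concatMap f (first (phase s) ++ (applyUpTo newMax k' ++ applyUpTo low (gap s + k))))
      ≡⟨ length-concatMap-++ (first (phase s)) _ ⟩
    length (concatMap f (first (phase s))) + length (concatMap f (applyUpTo newMax k' ++ applyUpTo low (gap s + k)))
      ≡⟨ cong₂ _+_ (length-first s) (length-concatMap-++ (applyUpTo newMax k') _) ⟩
    (if phase s then count n true 0 else 0) +
      (length (concatMap f (applyUpTo newMax k')) + length (concatMap f (applyUpTo low (gap s + k))))
      ≡⟨ cong (λ z → (if phase s then count n true 0 else 0) + z) (cong₂ _+_
           (≡.trans (length-concatMap-applyUpTo f newMax k')
             (≡.trans (Σ<-cong k' (λ j → length-ext n (next s (newMax j)))) (Σ<-const k' (count n false 0))))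
           (≡.trans (length-concatMap-applyUpTo f low (gap s + k))
             (Σ<-cong (gap s + k) (λ j → length-ext n (next s (low j)))))) ⟩
    count (suc n) (phase s) (gap s) ∎
    where
    open ≡.≡-Reasoning
    f : Move → List State
    f m = ext n (next s m)
    first : Bool → List Move
    first ph = if ph then newBase ∷ [] else []
    length-concatMap-++ : ∀ xs ys → length (concatMap f (xs ++ ys)) ≡ length (concatMap f xs) + length (concatMap f ys)
    length-concatMap-++ xs ys = ≡.trans (cong length (concatMap-++ f xs ys)) (length-++ (concatMap f xs))
    length-first : ∀ s → length (concatMap (λ m → ext n (next s m)) (first (phase s))) ≡
                   (if phase s then count n true 0 else 0)
    length-first (state false _ _ _)  = refl
    length-first s@(state true _ _ _) =
      ≡.trans (length-++ (ext n (next s newBase))) (≡.trans (ℕₚ.+-identityʳ _) (length-ext n (next s newBase)))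

  -- The invariant of reachable states.

  -- `cover` ensures that `newMax` and `low` moves land on a block. `base-max` places a new base
  -- block correctly, and `no-base-max` shows, when a tower is rebuilt, that the phase is still true
  -- whenever its base has to grow.
  record Inv (s : State) : Set where
    field
      top    : Block
      istop  : IsTop top (blocks s)
      gap≡   : maxcol s ≡ col top ℤ.+ + gap s
      ≤max   : ∀ {q} → q ∈ blocks s → col q ℤ.≤ maxcol s
      max∈   : ∃ λ y → (maxcol s , y) ∈ blocks s
      cover  : ∀ z → col top ℤ.< z ℤ.+ + k → z ℤ.< maxcol s ℤ.+ + k → ∃ λ q → q ∈ blocks s × Meet z (col q)
      b-1    : ℕ
      tower  : Tower (suc b-1) (blocks s)
      b≤     : suc b-1 ≤ length (blocks s)
      base-max    : phase s ≡ true → maxcol s ≡ + (b-1 * k)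
      no-base-max : phase s ≡ false → (maxcol s , 0) ∉ blocks s

  -- Supplies the hypothesis of `extend-isTop`. For `newBase` and `newMax` the new column is beyond
  -- every old one; for `low` this is the validity bound.
  top<column+k : ∀ {s m} (inv : Inv s) → Valid s m → col (Inv.top inv) ℤ.< column s m ℤ.+ + k
  top<column+k {s} {newBase} inv v = ℤₚ.≤-<-trans (Inv.≤max inv (IsTop.member (Inv.istop inv)))
    (ℤₚ.≤-<-trans (ℤₚ.i≤i+j (maxcol s) (+ k)) (x<x+k _))
  top<column+k {s} {newMax j} inv v = ℤₚ.≤-<-trans (Inv.≤max inv (IsTop.member (Inv.istop inv)))
    (ℤₚ.≤-<-trans (ℤₚ.i≤i+j (maxcol s) (+ suc j)) (x<x+k _))
  top<column+k {s} {low j} inv v =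
    offset<⇒<+k {x = column s (low j)} (≡.trans (sym (Inv.gap≡ inv)) (i≡i-j+j (maxcol s) (+ j))) v

  next-isTop : ∀ {s m} (inv : Inv s) → Valid s m →
               IsTop (column s m , height (column s m) (blocks s)) (extend (column s m) (blocks s))
  next-isTop {s} {m} inv v = extend-isTop (Inv.istop inv) (top<column+k {s} {m} inv v)

  inv-s₀ : Inv s₀
  inv-s₀ = record
    { top         = + 0 , 0
    ; istop       = isTop (here refl) ((λ ()) ∷ []) (λ { (here refl) _ → ℤₚ.≤-refl })
    ; gap≡        = refl
    ; ≤max        = λ { (here refl) → ℤₚ.≤-refl }
    ; max∈        = 0 , here refl
    ; cover       = λ z a b → _ , here refl , a , b
    ; b-1         = 0
    ; tower       = mkTower ([] ∷ []) (λ { zero _ → here refl ; (suc _) (s≤s ()) })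
                      (λ { x (here refl) → 0 , s≤s z≤n , refl }) (λ { x y (here ()) ; x y (there ()) })
    ; b≤          = s≤s z≤n
    ; base-max    = λ _ → refl
    ; no-base-max = λ ()
    }

  inv-next : ∀ {s m} → Inv s → Valid s m → Inv (next s m)
  inv-next {s} {newBase} inv v = record
    { top         = _
    ; istop       = next-isTop {s} {newBase} inv v
    ; gap≡        = sym (ℤₚ.+-identityʳ _)
    ; ≤max        = λ { (here refl) → ℤₚ.≤-refl ; (there q∈) → ℤₚ.≤-trans (≤max q∈) (ℤₚ.i≤i+j (maxcol s) (+ k)) }
    ; max∈        = _ , here refl
    -- The new block is both the latest and the one of largest column, so the two bounds on `z` say
    -- that it meets `z`.
    ; cover       = λ z a b → _ , here refl , a , b
    ; b-1         = suc b-1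
    ; tower       = proj₂ (extend-base x≡ (λ q∈ → ℤₚ.+-monoˡ-≤ (+ k) (≤max q∈)) tower)
    ; b≤          = s≤s b≤
    ; base-max    = λ _ → x≡
    ; no-base-max = λ ()
    }
    where
    open Inv inv
    x≡ : column s newBase ≡ + (suc b-1 * k)
    x≡ = ≡.trans (cong (ℤ._+ + k) (base-max v)) (ℤₚ.+-comm (+ (b-1 * k)) (+ k))
  inv-next {s} {newMax j} inv v = record
    { top         = _
    ; istop       = next-isTop {s} {newMax j} inv v
    ; gap≡        = sym (ℤₚ.+-identityʳ _)
    ; ≤max        = λ { (here refl) → ℤₚ.≤-refl ; (there q∈) → ℤₚ.≤-trans (≤max q∈) (ℤₚ.<⇒≤ M<x) }
    ; max∈        = _ , here refl
    ; cover       = λ z a b → _ , here refl , a , b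
    ; b-1         = b-1
    ; tower       = proj₁ supp
    ; b≤          = ℕₚ.m≤n⇒m≤1+n b≤
    ; base-max    = λ ()
    ; no-base-max = λ { _ (here e) → ℕₚ.<⇒≢ (proj₂ supp) (cong lev e) ; _ (there q∈) → ℤₚ.<⇒≱ M<x (≤max q∈) }
    }
    where
    open Inv inv
    M<x : maxcol s ℤ.< column s (newMax j)
    M<x = subst (ℤ._< column s (newMax j)) (ℤₚ.+-identityʳ (maxcol s)) (ℤₚ.+-monoʳ-< (maxcol s) (ℤ.+<+ (s≤s z≤n)))
    supp = extend-supported (cover (column s (newMax j)) (top<column+k {s} {newMax j} inv v)
             (ℤₚ.+-monoʳ-< (maxcol s) (ℤ.+<+ (s≤s v)))) tower
  inv-next {s} {low j} inv v = record
    { top         = _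
    ; istop       = next-isTop {s} {low j} inv v
    ; gap≡        = i≡i-j+j (maxcol s) (+ j)
    ; ≤max        = λ { (here refl) → x≤M ; (there q∈) → ≤max q∈ }
    ; max∈        = _ , there (proj₂ max∈)
    ; cover       = cover′
    ; b-1         = b-1
    ; tower       = proj₁ supp
    ; b≤          = ℕₚ.m≤n⇒m≤1+n b≤
    ; base-max    = base-max
    ; no-base-max = λ { _ (here e) → ℕₚ.<⇒≢ (proj₂ supp) (cong lev e) ; e (there q∈) → no-base-max e q∈ }
    }
    where
    open Inv inv
    x : ℤ
    x = column s (low j)
    x≤M : x ℤ.≤ maxcol s
    x≤M = ℤₚ.i-j≤i (maxcol s) (+ j)
    top<x+k : col top ℤ.< x ℤ.+ + k
    top<x+k = top<column+k {s} {low j} inv v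
    supp = extend-supported (cover x top<x+k (ℤₚ.≤-<-trans x≤M (x<x+k (maxcol s)))) tower
    cover′ : ∀ z → x ℤ.< z ℤ.+ + k → z ℤ.< maxcol s ℤ.+ + k → ∃ λ q → q ∈ extend x (blocks s) × Meet z (col q)
    -- Left of `x + k` the new block itself meets `z`. From `x + k` on, `z` is beyond the column of
    -- the former top, so the old `cover` applies.
    cover′ z a b with z ℤₚ.<? x ℤ.+ + k
    ... | yes c = _ , here refl , a , c
    ... | no ¬c with cover z (ℤₚ.<-trans (ℤₚ.<-≤-trans top<x+k (ℤₚ.≮⇒≥ ¬c)) (x<x+k z)) b
    ...   | q , q∈ , m = q , there q∈ , m

  Reach⇒Inv : ∀ {n s} → Reach n s → Inv s
  Reach⇒Inv start        = inv-s₀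
  Reach⇒Inv (step m r v) = inv-next {m = m} (Reach⇒Inv r) v

  length-blocks : ∀ {n s} → Reach n s → length (blocks s) ≡ suc n
  length-blocks start              = refl
  length-blocks (step {s = s} m r v) = ≡.trans (cong length (blocks-next s m)) (cong suc (length-blocks r))

  -- The latest block is the unique top of the block set, so the latest blocks on both sides agree.
  -- Removing them leaves equal states by induction, and the column then determines the move.
  Reach-injective : ∀ {n s t} → Reach n s → Reach n t → blocks s ↭ blocks t → s ≡ t
  Reach-injective start start _ = refl
  Reach-injective (step {s = s} m r v) (step {s = t} m′ r′ v′) p
    with isTop-unique (IsTop-resp-↭ p′ (next-isTop {s} {m} (Reach⇒Inv r) v)) (next-isTop {t} {m′} (Reach⇒Inv r′) v′)
    where
    p′ : extend (column s m) (blocks s) ↭ extend (column t m′) (blocks t)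
    p′ = ≡.subst₂ _↭_ (blocks-next s m) (blocks-next t m′) p
  ... | e with Reach-injective r r′ (drop-∷ (subst (λ q → q ∷ blocks s ↭ extend (column t m′) (blocks t)) e
                 (≡.subst₂ _↭_ (blocks-next s m) (blocks-next t m′) p)))
  ...   | refl = cong (next s) (column-injective s v v′ (cong col e))

  -- Removing the rightmost free block.

  module RemoveTop {b-1 : ℕ} {p : Block} {R : List Block}
                   (tower : Tower (suc b-1) (p ∷ R)) (istop : IsTop p (p ∷ R)) where
    open Tower tower
    open IsTop istop

    p-disjoint : ∀ {q} → q ∈ R → NonOverlap k p q
    p-disjoint = All.lookup (AllPairs.head disjoint)

    -- The support of a remaining block cannot be `p`, because `p` is free.
    supported′ : ∀ x y → (x , suc y) ∈ R → ∃ λ x′ → ((x′ , y) ∈ R) × Meet x x′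
    supported′ x y xy∈ with supported x y (there xy∈)
    ... | x′ , there x′∈ , m = x′ , x′∈ , m
    ... | x′ , here refl , m = contradiction (Meet-sym m) (All.lookup free (there xy∈) ℕₚ.≤-refl)

    remove-nonbase : 0 < lev p → Tower (suc b-1) R
    remove-nonbase p>0 = mkTower (AllPairs.tail disjoint) base⊇′ (λ x x∈ → base⊆ x (there x∈)) supported′
      where
      base⊇′ : ∀ i → i < suc b-1 → (+ (i * k) , 0) ∈ R
      base⊇′ i i< with base⊇ i i<
      ... | here refl = contradiction p>0 (ℕₚ.<-irrefl refl)
      ... | there x∈  = x∈

    module _ (p≡0 : lev p ≡ 0) where

      apart-above : ∀ {q} → q ∈ R → 0 < lev q → (col p ℤ.+ + k ℤ.≤ col q) ⊎ (col q ℤ.+ + k ℤ.≤ col p)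
      apart-above {q} q∈ q>0 = ¬Meet⇒apart (col p) (col q)
        (All.lookup free (there q∈) (subst (_< lev q) (sym p≡0) q>0))

      -- Otherwise a base block follows `p`. Being at or beyond `col p + k` passes to higher blocks
      -- that meet such a block, since they cannot meet the free block `p`. So some free block would
      -- lie to the right of `p`.
      last-base : col p ≡ + (b-1 * k)
      last-base with base⊆ (col p) (here (cong (col p ,_) (sym p≡0)))
      ... | j , j<1+b , x≡ with ℕₚ.m<1+n⇒m<n∨m≡n j<1+b
      ...   | inj₂ refl = x≡
      ...   | inj₁ j<b with free-∈ (p ∷ R) (λ q → col p ℤ.+ + k ℤₚ.≤? col q) closed
                              (lose (base⊇ (suc j) (s≤s j<b)) (ℤₚ.≤-reflexive
                                (≡.trans (cong (ℤ._+ + k) x≡) (ℤₚ.+-comm (+ (j * k)) (+ k)))))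
        where
        closed : ∀ {q r} → r ∈ p ∷ R → col p ℤ.+ + k ℤ.≤ col q → lev q < lev r → Meet (col q) (col r) →
                 col p ℤ.+ + k ℤ.≤ col r
        closed (here refl) _ lt _ = contradiction (subst (_ <_) p≡0 lt) λ ()
        closed (there r∈) le lt (_ , m) with apart-above r∈ (ℕₚ.≤-<-trans z≤n lt)
        ... | inj₁ a = a
        ... | inj₂ a = contradiction (ℤₚ.<-≤-trans m a) (ℤₚ.≤⇒≯ (ℤₚ.≤-trans (ℤₚ.<⇒≤ (x<x+k (col p))) le))
      ...     | q , q∈ , le , fq = contradiction (ℤₚ.<-≤-trans (x<x+k (col p)) le) (ℤₚ.≤⇒≯ (rightmost q∈ fq))

      -- By induction on the level: a block supported from the left of `p` can neither meet `p` nor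
      -- lie beyond it. Following supports down ends at another base block, hence `0 < b-1`.
      left : ∀ y x → (x , y) ∈ R → (x ℤ.+ + k ℤ.≤ col p) × 0 < b-1
      left zero x x∈ with base⊆ x (there x∈)
      ... | i , i<1+b , refl with ℕₚ.m<1+n⇒m<n∨m≡n i<1+b
      ...   | inj₂ refl = contradiction (≡.cong₂ _,_ last-base p≡0) (NonOverlap⇒≢ {p} {x , 0} (p-disjoint x∈))
      ...   | inj₁ i<b  =
        ≡.subst₂ ℤ._≤_ (ℤₚ.+-comm (+ k) (+ (i * k))) (sym last-base) (ℤ.+≤+ (ℕₚ.*-monoˡ-≤ k i<b)) ,
        ℕₚ.≤-<-trans z≤n i<b
      left (suc y) x x∈ with supported′ x y x∈
      ... | x′ , x′∈ , (_ , m) with left y x′ x′∈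
      ...   | le , b>0 with apart-above x∈ (s≤s z≤n)
      ...     | inj₁ a = contradiction (ℤₚ.<-≤-trans m le) (ℤₚ.≤⇒≯ (ℤₚ.≤-trans (ℤₚ.<⇒≤ (x<x+k (col p))) a))
      ...     | inj₂ a = a , b>0

      remove-base : ∀ {q} → q ∈ R → ∃ λ b-2 → b-1 ≡ suc b-2 × Tower (suc b-2) R
      remove-base {x , y} q∈ with positive⇒suc (proj₂ (left y x q∈))
      ... | b-2 , eq = b-2 , eq , mkTower (AllPairs.tail disjoint) base⊇′ base⊆′ supported′
        where
        base⊇′ : ∀ i → i < suc b-2 → (+ (i * k) , 0) ∈ R
        base⊇′ i i< with base⊇ i (subst (i <_) (cong suc (sym eq)) (ℕₚ.m<n⇒m<1+n i<))
        ... | there x∈ = x∈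
        ... | here e   = contradiction
          (ℕₚ.*-cancelʳ-≡ i (suc b-2) k (ℤₚ.+-injective (≡.trans (cong col e) (≡.trans last-base (cong (λ b → + (b * k)) eq)))))
          (ℕₚ.<⇒≢ i<)
        base⊆′ : ∀ x → (x , 0) ∈ R → ∃ λ i → (i < suc b-2) × (x ≡ + (i * k))
        base⊆′ x x∈ with base⊆ x (there x∈)
        ... | i , i<1+b , x≡ with ℕₚ.m<1+n⇒m<n∨m≡n i<1+b
        ...   | inj₁ i<b  = i , subst (i <_) eq i<b , x≡
        ...   | inj₂ refl = contradiction (≡.cong₂ _,_ (≡.trans last-base (sym x≡)) p≡0)
                                          (NonOverlap⇒≢ {p} {x , 0} (p-disjoint x∈))

  -- Every tower is reached by dropping blocks.

  Reach-extend : ∀ {n s m x y R} → Reach n s → Valid s m → R ↭ blocks s → column s m ≡ x →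
                 height x (blocks s) ≡ y → ∃ λ t → Reach (suc n) t × (x , y) ∷ R ↭ blocks t
  Reach-extend {s = s} {m} r v p refl refl =
    next s m , step m r v , trans (prep _ p) (↭-reflexive (sym (blocks-next s m)))

  -- The top block is removed, the rest is reached by induction, and the block is put back by the
  -- move that its column dictates.
  Tower⇒Reach : ∀ n {b-1} S → length S ≡ suc n → Tower (suc b-1) S → ∃ λ s → Reach n s × S ↭ blocks s
  Tower⇒Reach zero (q ∷ []) refl t with Tower.base⊇ t 0 (s≤s z≤n)
  ... | here refl = s₀ , start , ↭-refl
  Tower⇒Reach (suc n) {b-1} S len t with top-exists S (Tower.base⊇ t 0 (s≤s z≤n))
  ... | p , istop with ∈⇒↭∷ (IsTop.member istop)
  ...   | R , S↭ = let s , r , q = reach p (Tower-resp-↭ S↭ t) (IsTop-resp-↭ S↭ istop) in s , r , trans S↭ q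
    where
    len-R : length R ≡ suc n
    len-R = ℕₚ.suc-injective (≡.trans (sym (↭-length S↭)) len)

    R-inhabited : ∀ R → length R ≡ suc n → ∃ λ q → q ∈ R
    R-inhabited (q ∷ _) _ = q , here refl

    reach : ∀ p → Tower (suc b-1) (p ∷ R) → IsTop p (p ∷ R) → ∃ λ s → Reach (suc n) s × p ∷ R ↭ blocks s
    reach (x , zero) tower istop
      with RemoveTop.remove-base tower istop refl (proj₂ (R-inhabited R len-R))
    ... | b-2 , refl , towerR with Tower⇒Reach n R len-R towerR
    ...   | s , r , R↭ = Reach-extend {m = newBase} r phase≡ R↭ (sym x≡M+k)
              (height-unique x (blocks s) 0
                (λ {q} q∈ m → contradiction m (apart⇒¬Meet x (col q) (inj₂ (left q∈)))) (inj₁ refl))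
      where
      open Inv (Reach⇒Inv r) using (≤max; max∈; no-base-max)
      left : ∀ {q} → q ∈ blocks s → col q ℤ.+ + k ℤ.≤ x
      left {q} q∈ = proj₁ (RemoveTop.left tower istop refl (lev q) (col q) (∈-resp-↭ (↭-sym R↭) q∈))
      last : ℤ
      last = + (b-2 * k)
      x≡ : x ≡ last ℤ.+ + k
      x≡ = ≡.trans (RemoveTop.last-base tower istop refl) (ℤₚ.+-comm (+ k) last)
      last∈ : (last , 0) ∈ blocks s
      last∈ = ∈-resp-↭ R↭ (Tower.base⊇ towerR b-2 ℕₚ.≤-refl)
      -- All remaining blocks end at or before `x = last + k`, so none has a column beyond `last`.
      M≡last : maxcol s ≡ last
      M≡last = ℤₚ.≤-antisym
        (ℤₚ.≮⇒≥ λ last<M → ℤₚ.≤⇒≯ (subst (_ ℤ.≤_) x≡ (left (proj₂ max∈))) (ℤₚ.+-monoˡ-< (+ k) last<M))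
        (≤max last∈)
      x≡M+k : x ≡ maxcol s ℤ.+ + k
      x≡M+k = ≡.trans x≡ (cong (ℤ._+ + k) (sym M≡last))
      phase≡ : phase s ≡ true
      phase≡ with phase s in eq
      ... | true  = refl
      ... | false = contradiction (subst (λ z → (z , 0) ∈ blocks s) (sym M≡last) last∈) (no-base-max eq)
    reach (x , suc y) tower istop
      with Tower⇒Reach n R len-R (RemoveTop.remove-nonbase tower istop (s≤s z≤n))
    ... | s , r , R↭ = result
      where
      open Inv (Reach⇒Inv r) using (≤max; gap≡; top) renaming (istop to istop′)
      support : ∃ λ q → q ∈ blocks s × Meet x (col q) × suc (lev q) ≡ suc y
      support with Tower.supported tower x y (here refl)
      ... | x′ , there x′∈ , m = (x′ , y) , ∈-resp-↭ R↭ x′∈ , m , refl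
      below : ∀ {q} → q ∈ blocks s → Meet x (col q) → lev q < suc y
      below {q} q∈ m with ∈-resp-↭ (↭-sym R↭) q∈
      ... | q∈R with ℕₚ.<-cmp (lev q) (suc y)
      ...   | tri< a _ _ = a
      ...   | tri≈ _ e _ = contradiction (sym e)
                             (nonOverlap⇒lev≢ {x , suc y} {q} (RemoveTop.p-disjoint tower istop q∈R) m)
      ...   | tri> _ _ a = contradiction m (All.lookup (IsTop.free istop) (there q∈R) a)
      height≡ : height x (blocks s) ≡ suc y
      height≡ = height-unique x (blocks s) (suc y) below (inj₂ support)
      x<M+k : x ℤ.< maxcol s ℤ.+ + k
      x<M+k with support
      ... | q , q∈ , (_ , m) , _ = ℤₚ.<-≤-trans m (ℤₚ.+-monoˡ-≤ (+ k) (≤max q∈))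
      -- Were `top` at or beyond `x + k`, it would not meet the removed block, so it would be free
      -- in the whole tower and further right.
      top<x+k : col top ℤ.< x ℤ.+ + k
      top<x+k = ℤₚ.≰⇒> λ le → ℤₚ.<⇒≱ (ℤₚ.<-≤-trans (x<x+k x) le)
        (IsTop.rightmost istop (there (∈-resp-↭ (↭-sym R↭) (IsTop.member istop′)))
          ((λ _ m → apart⇒¬Meet x (col top) (inj₁ le) (Meet-sym m)) ∷
           All-resp-↭ (↭-sym R↭) (IsTop.free istop′)))
      result : ∃ λ t → Reach (suc n) t × (x , suc y) ∷ R ↭ blocks t
      -- A column up to `maxcol s` gives a `low` move. One beyond it gives a `newMax` move, because
      -- the supporting block forces `x` below `maxcol s + k`.
      result with x ℤₚ.≤? maxcol s
      ... | yes x≤M with ≤⇒∃+ x≤M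
      ...   | j , M≡x+j = Reach-extend {m = low j} r
                (<+k⇒offset< {x = x} (≡.trans (sym gap≡) M≡x+j) top<x+k) R↭
                (≡.trans (cong (ℤ._+ ℤ.- + j) M≡x+j) (lemma x (+ j))) height≡
        where
        lemma : ∀ a b → (a ℤ.+ b) ℤ.+ ℤ.- b ≡ a
        lemma = ℤR.solve-∀
      result | no x≰M with ≤⇒∃+ (ℤₚ.<⇒≤ (ℤₚ.≰⇒> x≰M))
      ...   | zero  , x≡ = contradiction (ℤₚ.≤-reflexive (≡.trans x≡ (ℤₚ.+-identityʳ (maxcol s)))) x≰M
      ...   | suc j , x≡ = Reach-extend {m = newMax j} r
                (ℕₚ.≤-pred (+-cancelˡ-< (maxcol s) (subst (ℤ._< maxcol s ℤ.+ + k) x≡ x<M+k))) R↭ (sym x≡) height≡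

  -- The list of all towers and its length.

  blocks-unique : ∀ {b S} → Tower b S → Unique S
  blocks-unique t = AllPairs.map (λ {p} {q} → NonOverlap⇒≢ {p} {q}) (Tower.disjoint t)

  canonical : State → List Block
  canonical s = sort (blocks s)

  towers : ℕ → List (List Block)
  towers n = map canonical (ext n s₀)

  ∈-ext⇒Reach : ∀ n {s} → s ∈ ext n s₀ → Reach n s
  ∈-ext⇒Reach n {s} s∈ = subst (λ i → Reach i s) (ℕₚ.+-identityʳ n) (ext⇒Reach n start s∈)

  towers-unique : ∀ n → Unique (towers n)
  towers-unique n = AllPairsₚ.map⁺ (AllPairs.map distinct (allPairs-∈ (ext-unique n s₀)))
    where
    distinct : ∀ {s t} → s ∈ ext n s₀ × t ∈ ext n s₀ × s ≢ t → canonical s ≢ canonical t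
    distinct {s} {t} (s∈ , t∈ , s≢t) eq = s≢t (Reach-injective (∈-ext⇒Reach n s∈) (∈-ext⇒Reach n t∈)
      (trans (sort-↭ (blocks s)) (trans (↭-reflexive eq) (↭-sym (sort-↭ (blocks t))))))

  towers-sound : ∀ n {S} → S ∈ towers n → IsTowerArea k (suc n) S
  towers-sound n S∈ with ∈-map⁻ canonical S∈
  ... | s , s∈ , refl =
    suc b-1 , s≤s z≤n , subst (suc b-1 ≤_) (length-blocks r) b≤ ,
    AllPairs⇒Linked (sort-sorted (blocks-unique tower)) ,
    ≡.trans (sym (↭-length (sort-↭ (blocks s)))) (length-blocks r) ,
    Tower.disjoint t , Tower.base⊇ t , Tower.base⊆ t , Tower.supported t
    where
    r : Reach n s
    r = ∈-ext⇒Reach n s∈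
    open Inv (Reach⇒Inv r) using (b-1; b≤; tower)
    t : Tower (suc b-1) (canonical s)
    t = Tower-resp-↭ (sort-↭ (blocks s)) tower

  towers-complete : ∀ n {S} → IsTowerArea k (suc n) S → S ∈ towers n
  towers-complete n {S} (suc b-1 , _ , _ , linked , len , d , b⊇ , b⊆ , supp)
    with Tower⇒Reach n S len (mkTower d b⊇ b⊆ supp)
  ... | s , r , S↭ = subst (_∈ towers n) (sym S≡) (∈-map⁺ canonical (Reach⇒ext r))
    where
    S≡ : S ≡ canonical s
    S≡ = sorted-↭⇒≡ (Linked⇒AllPairs (λ {p} {q} {r} → ≺-trans {p} {q} {r}) linked)
           (sort-sorted (blocks-unique (Inv.tower (Reach⇒Inv r)))) (trans S↭ (sort-↭ (blocks s)))

  length-towers : ∀ n → length (towers n) ≡ C-sum (n + k' * suc n) (suc n)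
  length-towers n = begin
    length (towers n)                        ≡⟨ length-map canonical (ext n s₀) ⟩
    length (ext n s₀)                        ≡⟨ length-ext n s₀ ⟩
    count n true 0                           ≡⟨ count-true n 0 ⟩
    C-sum (k * n + k' + 0) (suc n)           ≡⟨ cong (λ u → C-sum u (suc n)) (lemma k' n) ⟩
    C-sum (n + k' * suc n) (suc n)           ∎
    where
    open ≡.≡-Reasoning
    lemma : ∀ k' n → suc k' * n + k' + 0 ≡ n + k' * suc n
    lemma = ℕR.solve-∀

theorem1p1 : ∀ (k n : ℕ) → 1 ≤ k → 1 ≤ n →
    ∃ λ (Ts : List (List Block)) → Enumerates k n Ts ×
    (ℕ→ℚ (length Ts) ≡
    ℕ→ℚ ((k * n ∸ 1) C (n ∸ 1)) *ℚ
    ₂F₁-terminating 1ℚ (n ∸ 1) (ℕ→ℚ ((k ∸ 1) * n + 1)) (- 1ℚ))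
theorem1p1 (suc k') (suc n) _ _ =
  -- The upper index `k * suc n ∸ 1` computes to `n + e`, so only `suc e` has to be rewritten as
  -- `e + 1`.
  towers n , (towers-unique n , λ S → towers-sound n , towers-complete n) , (begin
    ℕ→ℚ (length (towers n))
      ≡⟨ cong ℕ→ℚ (length-towers n) ⟩
    ℕ→ℚ (C-sum (n + e) (suc n))
      ≡⟨ Hypergeometric.C*₂F₁≡C-sum n e ⟨
    ℕ→ℚ ((n + e) C n) *ℚ ₂F₁-terminating 1ℚ n (ℕ→ℚ (suc e)) (- 1ℚ)
      ≡⟨ cong (λ c → ℕ→ℚ ((n + e) C n) *ℚ ₂F₁-terminating 1ℚ n (ℕ→ℚ c) (- 1ℚ)) (ℕₚ.+-comm 1 e) ⟩
    ℕ→ℚ ((n + e) C n) *ℚ ₂F₁-terminating 1ℚ n (ℕ→ℚ (e + 1)) (- 1ℚ) ∎)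
  where
  open Towers k'
  open ≡.≡-Reasoning
  e : ℕ
  e = k' * suc n
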